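{- Let $l$ be a positive odd integer. Then there exists a positive integer $N_l$ (depending on $l$) such that for all integers $n\geq N_l$, the product $P_{2,l}(n)=\prod_{k=1}^n (2k^2+l)$ is not a perfect square. -}

module Defs where

open import Data.Nat using (ℕ; zero; suc; _+_; _*_)
open import Data.Product using (∃-syntax)
open import Relation.Binary.PropositionalEquality using (_≡_)

P2 : ℕ → ℕ → ℕ
P2 l zero = 1
P2 l (suc n) = P2 l n * (2 * (suc n * suc n) + l)

-- m is a perfect square. P2 l n is a nonnegative integer, so being the square
-- of a natural number is the same as being the square of an integer.
IsSquare : ℕ → Set
IsSquare m = ∃[ r ] (m ≡ r * r)

{-# OPTIONS --safe #-}
-- If P_n = ∏_{k≤n} (2k² + l) is a square and n ≥ l, then every prime dividing one of its
-- factors is at most 2n.  This is impossible for large n.  Restrict to the factors with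
-- k ≡ 1 (mod l), which are coprime to 2l: there are about T = n/l of them, and the
-- logarithm of their product is at least about 2T log T.  A prime p has at most two roots
-- modulo each p^j, so it contributes about 2T log p/(p − 1) ≤ 3T log p/p to that logarithm.
-- To bound the sum of log p/p over the primes that occur, consider the numbers
-- 2(a − a′)² + l(b − b′)² for all pairs of points of an m × m grid with m² = N ~ Cn.  If p
-- divides 2r² + l, it divides those with a ± rb ≡ a′ ± rb′ (mod p) for either sign, and by
-- convexity at least about N²/2p pairs coincide for each sign.  As all these numbers are
-- O(N), the sum of log p/p is at most about ½ log N.  Hence the product has logarithm at
-- most about (3/2) T log T, with an error that Chebyshev's bound for the primorial controls.
module Submission where

open import Defs
open import Data.Nat
open import Data.Nat.Properties
open import Data.Nat.Combinatorics using
  (_C_; nCn≡1; nCk≡nC[n∸k]; k>n⇒nCk≡0; nCk≡n!/k![n-k]!; k![n∸k]!∣n!; nCk+nC[k+1]≡[n+1]C[k+1])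
open import Data.Nat.Divisibility
open import Data.Nat.DivMod
open import Data.Nat.Induction using (<-rec)
open import Data.Nat.ListAction using (product)
open import Data.Nat.Primality
open import Data.Nat.Primality.Factorisation using (factorise; PrimeFactorisation)
open import Data.Nat.Tactic.RingSolver using (solve-∀)
open import Data.List.Base using (_∷_)
open import Data.List.Relation.Unary.All using (All; []; _∷_)
open import Data.Product using (_×_; _,_; ∃-syntax)
open import Data.Sum using (_⊎_; inj₁; inj₂; [_,_]′; reduce)
open import Function using (_∘_)
open import Relation.Nullary using (¬_; Dec; yes; no; contradiction)
open import Relation.Binary.PropositionalEquality
  using (_≡_; _≢_; refl; sym; trans; cong; cong₂; subst; subst₂; module ≡-Reasoning)

-- Finite sums and products, valuations, smooth parts

∑ ∏ : ℕ → (ℕ → ℕ) → ℕ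
∑ zero    f = 0
∑ (suc n) f = ∑ n f + f n
∏ zero    f = 1
∏ (suc n) f = ∏ n f * f n

+-interchange : ∀ a b c d → (a + b) + (c + d) ≡ (a + c) + (b + d)
+-interchange = solve-∀

*-interchange : ∀ a b c d → (a * b) * (c * d) ≡ (a * c) * (b * d)
*-interchange = solve-∀

∑-mono : ∀ n {f g} → (∀ i → i < n → f i ≤ g i) → ∑ n f ≤ ∑ n g
∑-mono zero    h = z≤n
∑-mono (suc n) h = +-mono-≤ (∑-mono n (λ i i<n → h i (m<n⇒m<1+n i<n))) (h n ≤-refl)

∑-cong : ∀ n {f g} → (∀ i → f i ≡ g i) → ∑ n f ≡ ∑ n g
∑-cong zero    h = refl
∑-cong (suc n) h = cong₂ _+_ (∑-cong n h) (h n)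

∑-+ : ∀ n f g → ∑ n (λ i → f i + g i) ≡ ∑ n f + ∑ n g
∑-+ zero    f g = refl
∑-+ (suc n) f g = trans (cong (_+ (f n + g n)) (∑-+ n f g))
                        (+-interchange (∑ n f) (∑ n g) (f n) (g n))

∑-*ˡ : ∀ n c f → ∑ n (λ i → c * f i) ≡ c * ∑ n f
∑-*ˡ zero    c f = sym (*-zeroʳ c)
∑-*ˡ (suc n) c f = trans (cong (_+ c * f n) (∑-*ˡ n c f)) (sym (*-distribˡ-+ c (∑ n f) (f n)))

∑-const : ∀ n c → ∑ n (λ _ → c) ≡ n * c
∑-const zero    c = refl
∑-const (suc n) c = trans (cong (_+ c) (∑-const n c)) (+-comm (n * c) c)

∑-zero : ∀ n → ∑ n (λ _ → 0) ≡ 0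
∑-zero n = trans (∑-const n 0) (*-zeroʳ n)

∑-swap : ∀ m n (f : ℕ → ℕ → ℕ) → ∑ m (λ i → ∑ n (f i)) ≡ ∑ n (λ j → ∑ m (λ i → f i j))
∑-swap zero    n f = sym (∑-zero n)
∑-swap (suc m) n f = trans (cong (_+ ∑ n (f m)) (∑-swap m n f))
                           (sym (∑-+ n (λ j → ∑ m (λ i → f i j)) (f m)))

∑-split : ∀ a b f → ∑ (a + b) f ≡ ∑ a f + ∑ b (λ i → f (a + i))
∑-split a zero    f = trans (cong (λ n → ∑ n f) (+-identityʳ a)) (sym (+-identityʳ _))
∑-split a (suc b) f = begin
  ∑ (a + suc b) f                              ≡⟨ cong (λ n → ∑ n f) (+-suc a b) ⟩
  ∑ (a + b) f + f (a + b)                      ≡⟨ cong (_+ f (a + b)) (∑-split a b f) ⟩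
  ∑ a f + ∑ b (λ i → f (a + i)) + f (a + b)    ≡⟨ +-assoc (∑ a f) _ _ ⟩
  ∑ a f + ∑ (suc b) (λ i → f (a + i))          ∎
  where open ≡-Reasoning

∑-nonzero : ∀ n f → 0 < ∑ n f → ∃[ i ] (i < n × 0 < f i)
∑-nonzero (suc n) f h with f n in eq
... | suc _ = n , ≤-refl , subst (0 <_) (sym eq) z<s
... | zero  with ∑-nonzero n f (subst (0 <_) (+-identityʳ _) h)
...   | i , i<n , pos = i , m<n⇒m<1+n i<n , pos

∏-mono : ∀ n {f g} → (∀ i → i < n → f i ≤ g i) → ∏ n f ≤ ∏ n g
∏-mono zero    h = ≤-refl
∏-mono (suc n) h = *-mono-≤ (∏-mono n (λ i i<n → h i (m<n⇒m<1+n i<n))) (h n ≤-refl)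

∏-cong : ∀ n {f g} → (∀ i → f i ≡ g i) → ∏ n f ≡ ∏ n g
∏-cong zero    h = refl
∏-cong (suc n) h = cong₂ _*_ (∏-cong n h) (h n)

∏-* : ∀ n f g → ∏ n (λ i → f i * g i) ≡ ∏ n f * ∏ n g
∏-* zero    f g = refl
∏-* (suc n) f g = trans (cong (_* (f n * g n)) (∏-* n f g))
                        (*-interchange (∏ n f) (∏ n g) (f n) (g n))

∏-one : ∀ n → ∏ n (λ _ → 1) ≡ 1
∏-one zero    = refl
∏-one (suc n) = trans (*-identityʳ _) (∏-one n)

∏-^ : ∀ n f k → ∏ n (λ i → f i ^ k) ≡ ∏ n f ^ k
∏-^ n f zero    = ∏-one n
∏-^ n f (suc k) = trans (∏-* n f (λ i → f i ^ k)) (cong (∏ n f *_) (∏-^ n f k))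

∏-const : ∀ n c → ∏ n (λ _ → c) ≡ c ^ n
∏-const zero    c = refl
∏-const (suc n) c = trans (*-comm _ c) (cong (c *_) (∏-const n c))

∏-exponents : ∀ n c f → ∏ n (λ i → c ^ f i) ≡ c ^ ∑ n f
∏-exponents zero    c f = refl
∏-exponents (suc n) c f = trans (cong (_* c ^ f n) (∏-exponents n c f)) (sym (^-distribˡ-+-* c (∑ n f) (f n)))

∏-pos : ∀ n {f} → (∀ i → i < n → 1 ≤ f i) → 1 ≤ ∏ n f
∏-pos n h = subst (_≤ ∏ n _) (∏-one n) (∏-mono n h)

∏-factor≤ : ∀ n {f q} → (∀ i → 1 ≤ f i) → q < n → f q ≤ ∏ n f
∏-factor≤ (suc n) {f} {q} h q<1+n with m<1+n⇒m<n∨m≡n q<1+n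
... | inj₁ q<n  = ≤-trans (∏-factor≤ n h q<n) (m≤m*n _ (f n) {{>-nonZero (h n)}})
... | inj₂ refl = m≤n*m (f n) (∏ n f) {{>-nonZero (∏-pos n (λ i _ → h i))}}

-- Meant for the smooth part of a prime, whose only factor other than 1 sits at the prime itself.
∏-spike≤ : ∀ n {f q X} → 1 ≤ X → f q ≤ X → (∀ i → i ≢ q → f i ≡ 1) → ∏ n f ≤ X
∏-spike≤ zero          1≤X fq h = 1≤X
∏-spike≤ (suc n) {f} {q} 1≤X fq h with n ≟ q
... | no  n≢q  rewrite h n n≢q | *-identityʳ (∏ n f) = ∏-spike≤ n 1≤X fq h
... | yes refl = ≤-trans (*-monoˡ-≤ (f n) (∏-spike≤′ n ≤-refl)) (≤-trans (≤-reflexive (*-identityˡ _)) fq)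
  where
  ∏-spike≤′ : ∀ k → k ≤ n → ∏ k f ≤ 1
  ∏-spike≤′ zero    _   = ≤-refl
  ∏-spike≤′ (suc k) k<n rewrite h k (<⇒≢ k<n) | *-identityʳ (∏ k f) = ∏-spike≤′ k (<⇒≤ k<n)

∏-split : ∀ a b f → ∏ (a + b) f ≡ ∏ a f * ∏ b (λ i → f (a + i))
∏-split a zero    f = trans (cong (λ n → ∏ n f) (+-identityʳ a)) (sym (*-identityʳ _))
∏-split a (suc b) f = begin
  ∏ (a + suc b) f                              ≡⟨ cong (λ n → ∏ n f) (+-suc a b) ⟩
  ∏ (a + b) f * f (a + b)                      ≡⟨ cong (_* f (a + b)) (∏-split a b f) ⟩
  ∏ a f * ∏ b (λ i → f (a + i)) * f (a + b)    ≡⟨ *-assoc (∏ a f) _ _ ⟩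
  ∏ a f * ∏ (suc b) (λ i → f (a + i))          ∎
  where open ≡-Reasoning

𝟙 : {P : Set} → Dec P → ℕ
𝟙 (yes _) = 1
𝟙 (no  _) = 0

𝟙-yes : {P : Set} (P? : Dec P) → P → 𝟙 P? ≡ 1
𝟙-yes (yes _) _ = refl
𝟙-yes (no ¬p) p = contradiction p ¬p

-- Searches downwards from `n` with default 0, hence the hypothesis `P 0` in `greatest-holds`.
-- Valuations, integer logarithms and an integer square root are all obtained from it.
greatest : {P : ℕ → Set} → (∀ i → Dec (P i)) → ℕ → ℕ
greatest P? zero = 0
greatest P? (suc n) with P? (suc n)
... | yes _ = suc n
... | no  _ = greatest P? n

greatest-holds : {P : ℕ → Set} (P? : ∀ i → Dec (P i)) → P 0 → ∀ n → P (greatest P? n)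
greatest-holds P? p0 zero = p0
greatest-holds P? p0 (suc n) with P? (suc n)
... | yes p = p
... | no  _ = greatest-holds P? p0 n

greatest-max : {P : ℕ → Set} (P? : ∀ i → Dec (P i)) → ∀ n {i} → i ≤ n → P i → i ≤ greatest P? n
greatest-max P? zero    i≤n p = i≤n
greatest-max P? (suc n) {i} i≤n p with P? (suc n)
... | yes _  = i≤n
... | no  ¬p with m≤n⇒m<n∨m≡n i≤n
...   | inj₁ i<1+n = greatest-max P? n (s≤s⁻¹ i<1+n) p
...   | inj₂ refl  = contradiction p ¬p

-- Makes `m` itself a sufficient search bound for the exponents `j` with `b ^ j` at most `m`.
n<b^n : ∀ {b} → 1 < b → ∀ n → n < b ^ n
n<b^n 1<b zero = ≤-refl
n<b^n {b} 1<b (suc n) = begin-strict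
  suc n           ≤⟨ n<b^n 1<b n ⟩
  b ^ n           <⟨ m<m*n (b ^ n) b {{m^n≢0 b n {{>-nonZero (<-trans z<s 1<b)}}}} 1<b ⟩
  b ^ n * b       ≡⟨ *-comm (b ^ n) b ⟩
  b ^ suc n       ∎
  where open ≤-Reasoning

prime>1 : ∀ {p} → Prime p → 1 < p
prime>1 p-prime = nonTrivial⇒n>1 _ {{prime⇒nonTrivial p-prime}}

prime>0 : ∀ {p} → Prime p → 0 < p
prime>0 p-prime = <-trans z<s (prime>1 p-prime)

^-∣-^ : ∀ p {i j} → i ≤ j → p ^ i ∣ p ^ j
^-∣-^ p {i} {j} i≤j = divides (p ^ (j ∸ i))
  (trans (cong (p ^_) (sym (m∸n+n≡m i≤j))) (^-distribˡ-+-* p (j ∸ i) i))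

-- The p-adic valuation of m; junk unless p is prime and m is positive.
v : ℕ → ℕ → ℕ
v p m = greatest (λ j → p ^ j ∣? m) m

v-∣ : ∀ p m → p ^ v p m ∣ m
v-∣ p m = greatest-holds (λ j → p ^ j ∣? m) (1∣ m) m

v-max : ∀ {p m j} → 1 < p → 0 < m → p ^ j ∣ m → j ≤ v p m
v-max {p} {m} {j} 1<p 0<m d = greatest-max (λ j → p ^ j ∣? m) m
  (≤-trans (<⇒≤ (n<b^n 1<p j)) (∣⇒≤ {{>-nonZero 0<m}} d)) d

∤⇒v≡0 : ∀ {p m} → ¬ p ∣ m → v p m ≡ 0
∤⇒v≡0 {p} {m} p∤m with v p m | v-∣ p m
... | zero  | _ = refl
... | suc j | d = contradiction (m*n∣⇒m∣ p (p ^ j) d) p∤m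

v>0⇒∣ : ∀ {p m} → 0 < v p m → p ∣ m
v>0⇒∣ {p} {m} h with v p m | v-∣ p m
... | suc j | d = m*n∣⇒m∣ p (p ^ j) d

∣⇒v>0 : ∀ {p m} → Prime p → 0 < m → p ∣ m → 0 < v p m
∣⇒v>0 {p} p-prime 0<m p∣m = v-max (prime>1 p-prime) 0<m (subst (_∣ _) (sym (^-identityʳ p)) p∣m)

-- One more factor `p` in the cofactor would contradict the maximality of `v p a`.
v-cofactor : ∀ {p a} → Prime p → 0 < a → ∃[ a′ ] (a ≡ p ^ v p a * a′ × ¬ p ∣ a′)
v-cofactor {p} {a} p-prime 0<a = q , a≡ , λ p∣q → <-irrefl refl
    (v-max {p} {a} {suc (v p a)} (prime>1 p-prime) 0<a
      (subst (p * p ^ v p a ∣_) (trans (*-comm q _) (sym a≡)) (*-monoˡ-∣ _ p∣q)))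
  where
  q = quotient (v-∣ p a)
  a≡ = m∣n⇒n≡m*quotient (v-∣ p a)

v-* : ∀ {p a b} → Prime p → 0 < a → 0 < b → v p (a * b) ≡ v p a + v p b
v-* {p} {a} {b} p-prime 0<a 0<b = ≤-antisym upper lower
  where
  0<ab = *-mono-≤ 0<a 0<b
  lower : v p a + v p b ≤ v p (a * b)
  lower = v-max (prime>1 p-prime) 0<ab
    (subst (_∣ a * b) (sym (^-distribˡ-+-* p (v p a) (v p b))) (*-pres-∣ (v-∣ p a) (v-∣ p b)))
  upper : v p (a * b) ≤ v p a + v p b
  upper with v p (a * b) ≤? v p a + v p b
  ... | yes le = le
  -- Otherwise p^(e+1), with e the sum of the valuations, divides ab = p^e a′b′, so `p` divides a
  -- cofactor.
  ... | no  gt with v-cofactor p-prime 0<a | v-cofactor p-prime 0<b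
  ...   | a′ , a≡ , p∤a′ | b′ , b≡ , p∤b′ with euclidsLemma a′ b′ p-prime p∣a′b′
    where
    e = v p a + v p b
    ab≡ : a * b ≡ p ^ e * (a′ * b′)
    ab≡ = begin
      a * b                                   ≡⟨ cong₂ _*_ a≡ b≡ ⟩
      (p ^ v p a * a′) * (p ^ v p b * b′)     ≡⟨ *-interchange (p ^ v p a) a′ (p ^ v p b) b′ ⟩
      (p ^ v p a * p ^ v p b) * (a′ * b′)     ≡⟨ cong (_* (a′ * b′)) (^-distribˡ-+-* p (v p a) (v p b)) ⟨
      p ^ e * (a′ * b′)                       ∎
      where open ≡-Reasoning
    p∣a′b′ : p ∣ a′ * b′
    p∣a′b′ = *-cancelˡ-∣ (p ^ e) {{m^n≢0 p e {{prime⇒nonZero p-prime}}}}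
      (subst₂ _∣_ (*-comm p (p ^ e)) ab≡ (∣-trans (^-∣-^ p (≰⇒> gt)) (v-∣ p (a * b))))
  ...     | inj₁ d = contradiction d p∤a′
  ...     | inj₂ d = contradiction d p∤b′

v-1 : ∀ {p} → Prime p → v p 1 ≡ 0
v-1 p-prime = ∤⇒v≡0 (λ p∣1 → <-irrefl (sym (∣1⇒≡1 p∣1)) (prime>1 p-prime))

v-∏ : ∀ {p} → Prime p → ∀ n {f} → (∀ i → i < n → 0 < f i) → v p (∏ n f) ≡ ∑ n (λ i → v p (f i))
v-∏ p-prime zero    h = v-1 p-prime
v-∏ {p} p-prime (suc n) {f} h =
  trans (v-* p-prime (∏-pos n h′) (h n ≤-refl)) (cong (_+ v p (f n)) (v-∏ p-prime n h′))
  where h′ = λ i i<n → h i (m<n⇒m<1+n i<n)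

-- Turns a product over primes into one over all indices below a bound: the other indices contribute
-- 1, so exponents have to be compared at primes only.
primeOr1 : ℕ → ℕ
primeOr1 i with prime? i
... | yes _ = i
... | no  _ = 1

primeOr1-prime : ∀ {p} → Prime p → primeOr1 p ≡ p
primeOr1-prime {p} p-prime with prime? p
... | yes _ = refl
... | no ¬p = contradiction p-prime ¬p

primeOr1≥1 : ∀ i → 1 ≤ primeOr1 i
primeOr1≥1 i with prime? i
... | yes p = prime>0 p
... | no  _ = ≤-refl

primeOr1^≥1 : ∀ i k → 1 ≤ primeOr1 i ^ k
primeOr1^≥1 i k = m^n>0 (primeOr1 i) {{>-nonZero (primeOr1≥1 i)}} k

primeOr1-^-mono : ∀ i {a b} → (Prime i → a ≤ b) → primeOr1 i ^ a ≤ primeOr1 i ^ b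
primeOr1-^-mono i {a} {b} h with prime? i
... | yes p = ^-monoʳ-≤ i {{prime⇒nonZero p}} (h p)
... | no  _ = ≤-reflexive (trans (^-zeroˡ a) (sym (^-zeroˡ b)))

primeOr1-^-cong : ∀ i {a b} → (Prime i → a ≡ b) → primeOr1 i ^ a ≡ primeOr1 i ^ b
primeOr1-^-cong i h = ≤-antisym (primeOr1-^-mono i (≤-reflexive ∘ h))
                                (primeOr1-^-mono i (≤-reflexive ∘ sym ∘ h))

-- The part of `m` made up of the primes below `M`.
smoothPart : ℕ → ℕ → ℕ
smoothPart M m = ∏ M (λ i → primeOr1 i ^ v i m)

smoothPart-1 : ∀ M → smoothPart M 1 ≡ 1
smoothPart-1 M = trans (∏-cong M (λ i → primeOr1-^-cong i {b = 0} v-1)) (∏-one M)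

smoothPart-* : ∀ M {a b} → 0 < a → 0 < b → smoothPart M (a * b) ≡ smoothPart M a * smoothPart M b
smoothPart-* M {a} {b} 0<a 0<b = trans
  (∏-cong M (λ i → trans (primeOr1-^-cong i (λ p → v-* p 0<a 0<b))
                         (^-distribˡ-+-* (primeOr1 i) (v i a) (v i b))))
  (∏-* M _ _)

smoothPart-prime≤ : ∀ M {q} → Prime q → smoothPart M q ≤ q
smoothPart-prime≤ M {q} q-prime = ∏-spike≤ M (prime>0 q-prime)
  (subst (λ x → x ^ v q q ≤ q) (sym (primeOr1-prime q-prime)) (∣⇒≤ {{prime⇒nonZero q-prime}} (v-∣ q q)))
  (λ i i≢q → primeOr1-^-cong i {b = 0} (λ i-prime → ∤⇒v≡0 (i∤q i i≢q i-prime)))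
  where
  i∤q : ∀ i → i ≢ q → Prime i → ¬ i ∣ q
  i∤q i i≢q i-prime i∣q with prime⇒irreducible q-prime i∣q
  ... | inj₁ refl = ¬prime[1] i-prime
  ... | inj₂ i≡q  = i≢q i≡q

smoothPart-prime≥ : ∀ {M q} → Prime q → q < M → q ≤ smoothPart M q
smoothPart-prime≥ {M} {q} q-prime q<M = begin
  q                          ≡⟨ trans (^-identityʳ _) (primeOr1-prime q-prime) ⟨
  primeOr1 q ^ 1             ≤⟨ primeOr1-^-mono q (λ _ → ∣⇒v>0 q-prime (prime>0 q-prime) ∣-refl) ⟩
  primeOr1 q ^ v q q         ≤⟨ ∏-factor≤ M (λ i → primeOr1^≥1 i (v i q)) q<M ⟩
  smoothPart M q             ∎
  where open ≤-Reasoning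

-- Multiplicativity of the smooth part reduces this bound and the next one to single primes.
smoothPart-product≤ : ∀ M {ps} → All Prime ps → smoothPart M (product ps) ≤ product ps
smoothPart-product≤ M [] = ≤-reflexive (smoothPart-1 M)
smoothPart-product≤ M (p ∷ ps) = ≤-trans
  (≤-reflexive (smoothPart-* M (prime>0 p) (productOfPrimes≥1 ps)))
  (*-mono-≤ (smoothPart-prime≤ M p) (smoothPart-product≤ M ps))

smoothPart-product≥ : ∀ {M ps} → All Prime ps → (∀ {q} → Prime q → q ∣ product ps → q < M) →
                      product ps ≤ smoothPart M (product ps)
smoothPart-product≥ {M} [] h = ≤-reflexive (sym (smoothPart-1 M))
smoothPart-product≥ {M} {p ∷ ps} (pp ∷ pps) h = ≤-trans
  (*-mono-≤ (smoothPart-prime≥ pp (h pp (m∣m*n (product ps))))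
            (smoothPart-product≥ pps (λ q q∣ → h q (∣n⇒∣m*n p q∣))))
  (≤-reflexive (sym (smoothPart-* M (prime>0 pp) (productOfPrimes≥1 pps))))

smoothPart≤ : ∀ M {m} → 0 < m → smoothPart M m ≤ m
smoothPart≤ M {m} 0<m = subst (λ x → smoothPart M x ≤ x) (sym isFactorisation)
    (smoothPart-product≤ M factorsPrime)
  where open PrimeFactorisation (factorise m {{>-nonZero 0<m}})

smooth⇒≤smoothPart : ∀ {M m} → 0 < m → (∀ {q} → Prime q → q ∣ m → q < M) → m ≤ smoothPart M m
smooth⇒≤smoothPart {M} {m} 0<m h = subst (λ x → x ≤ smoothPart M x) (sym isFactorisation)
    (smoothPart-product≥ factorsPrime (λ q q∣ → h q (subst (_ ∣_) (sym isFactorisation) q∣)))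
  where open PrimeFactorisation (factorise m {{>-nonZero 0<m}})

-- Chebyshev's bound

nC0≡1 : ∀ n → n C 0 ≡ 1
nC0≡1 n = trans (nCk≡nC[n∸k] {0} {n} z≤n) (nCn≡1 n)

nCk≤2^n : ∀ n k → n C k ≤ 2 ^ n
nCk≤2^n n       zero    = subst (_≤ 2 ^ n) (sym (nC0≡1 n)) (m^n>0 2 n)
nCk≤2^n zero    (suc k) = subst (_≤ 1) (sym (k>n⇒nCk≡0 (z<s {k}))) z≤n
nCk≤2^n (suc n) (suc k) = subst (_≤ 2 ^ suc n) (nCk+nC[k+1]≡[n+1]C[k+1] n k)
  (≤-trans (+-mono-≤ (nCk≤2^n n k) (nCk≤2^n n (suc k)))
           (≤-reflexive (cong (2 ^ n +_) (sym (+-identityʳ (2 ^ n))))))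

[a+b]Cb*b!*a!≡[a+b]! : ∀ a b → ((a + b) C b) * (b ! * a !) ≡ (a + b) !
[a+b]Cb*b!*a!≡[a+b]! a b = subst (λ x → ((a + b) C b) * (b ! * x !) ≡ (a + b) !) (m+n∸n≡m a b)
  (trans (cong (_* (b ! * (a + b ∸ b) !)) (nCk≡n!/k![n-k]! b≤a+b)) (m/n*n≡m (k![n∸k]!∣n! b≤a+b)))
  where
  b≤a+b = m≤n+m b a
  instance _ = b !* (a + b ∸ b) !≢0

prime∣!⇒≤ : ∀ {p} n → Prime p → p ∣ n ! → p ≤ n
prime∣!⇒≤ zero    p-prime d = contradiction (subst Prime (∣1⇒≡1 d) p-prime) ¬prime[1]
prime∣!⇒≤ (suc n) p-prime d with euclidsLemma (suc n) (n !) p-prime d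
... | inj₁ d′ = ∣⇒≤ d′
... | inj₂ d′ = m≤n⇒m≤1+n (prime∣!⇒≤ n p-prime d′)

≤⇒∣! : ∀ {m n} → 0 < m → m ≤ n → m ∣ n !
≤⇒∣! {suc m} _ m≤n = ∣-trans (m∣m*n (m !)) (m≤n⇒m!∣n! m≤n)

-- `p` divides (a + b)! but neither a! nor b!.
prime∣binomial : ∀ {a b p} → Prime p → b ≤ a → a < p → p ≤ a + b → p ∣ ((a + b) C b)
prime∣binomial {a} {b} {p} p-prime b≤a a<p p≤a+b
  with euclidsLemma ((a + b) C b) (b ! * a !) p-prime
         (subst (p ∣_) (sym ([a+b]Cb*b!*a!≡[a+b]! a b)) (≤⇒∣! (prime>0 p-prime) p≤a+b))
... | inj₁ d = d
... | inj₂ d with euclidsLemma (b !) (a !) p-prime d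
...   | inj₁ d′ = contradiction (≤-trans (prime∣!⇒≤ b p-prime d′) b≤a) (<⇒≱ a<p)
...   | inj₂ d′ = contradiction (prime∣!⇒≤ a p-prime d′) (<⇒≱ a<p)

binomial>0 : ∀ a b → 0 < ((a + b) C b)
binomial>0 a b with (a + b) C b in eq
... | suc _ = z<s
... | zero  = contradiction (subst (λ c → c * (b ! * a !) ≡ (a + b) !) eq ([a+b]Cb*b!*a!≡[a+b]! a b))
                            (<⇒≢ (n≢0⇒n>0 (≢-nonZero⁻¹ _ {{(a + b) !≢0}})))

-- All primes from a + 1 to a + b divide the binomial coefficient, so their product is at most its
-- smooth part.
primorial-step : ∀ {a b} → b ≤ a → ∏ b (λ i → primeOr1 (suc a + i)) ≤ 2 ^ (a + b)
primorial-step {a} {b} b≤a = begin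
  ∏ b (λ i → primeOr1 (suc a + i))                    ≤⟨ ∏-mono b pointwise ⟩
  ∏ b (λ i → f (suc a + i))                           ≤⟨ m≤n*m _ (∏ (suc a) f) {{>-nonZero (∏-pos (suc a) (λ i _ → primeOr1^≥1 i (v i c)))}} ⟩
  ∏ (suc a) f * ∏ b (λ i → f (suc a + i))             ≡⟨ ∏-split (suc a) b f ⟨
  smoothPart (suc a + b) c                            ≤⟨ smoothPart≤ (suc a + b) (binomial>0 a b) ⟩
  c                                                   ≤⟨ nCk≤2^n (a + b) b ⟩
  2 ^ (a + b)                                         ∎
  where
  open ≤-Reasoning
  c = (a + b) C b
  f = λ i → primeOr1 i ^ v i c
  pointwise : ∀ i → i < b → primeOr1 (suc a + i) ≤ f (suc a + i)
  pointwise i i<b = subst (_≤ f (suc a + i)) (^-identityʳ _) (primeOr1-^-mono (suc a + i)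
    (λ p → ∣⇒v>0 p (binomial>0 a b)
      (prime∣binomial p b≤a (s≤s (m≤m+n a i)) (subst (_≤ a + b) (+-suc a i) (+-monoʳ-≤ a i<b)))))

-- Induction by halving: the primes up to ⌈n/2⌉ are covered by the hypothesis, the others by
-- `primorial-step`. For n ≥ 2 one has a + b ≤ 2b + 1 ≤ 4b, so 2^(a+b) ≤ 16^b.
primorial≤16^n : ∀ n → ∏ (suc n) primeOr1 ≤ 16 ^ n
primorial≤16^n = <-rec _ step
  where
  step : ∀ n → (∀ {k} → k < n → ∏ (suc k) primeOr1 ≤ 16 ^ k) → ∏ (suc n) primeOr1 ≤ 16 ^ n
  step zero          rec = ≤-refl
  step (suc zero)    rec = s≤s z≤n
  step n@(suc (suc n-2)) rec = begin
    ∏ (suc n) primeOr1                                            ≡⟨ cong (λ k → ∏ (suc k) primeOr1) n≡ ⟩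
    ∏ (suc a + b) primeOr1                                        ≡⟨ ∏-split (suc a) b primeOr1 ⟩
    ∏ (suc a) primeOr1 * ∏ b (λ i → primeOr1 (suc a + i))         ≤⟨ *-mono-≤ (rec (⌈n/2⌉<n n-2)) (primorial-step b≤a) ⟩
    16 ^ a * 2 ^ (a + b)                                          ≤⟨ *-monoʳ-≤ (16 ^ a) (^-monoʳ-≤ 2 a+b≤4b) ⟩
    16 ^ a * 2 ^ (4 * b)                                          ≡⟨ cong (16 ^ a *_) (^-*-assoc 2 4 b) ⟨
    16 ^ a * 16 ^ b                                               ≡⟨ ^-distribˡ-+-* 16 a b ⟨
    16 ^ (a + b)                                                  ≡⟨ cong (16 ^_) n≡ ⟨
    16 ^ n                                                        ∎
    where
    open ≤-Reasoning
    a = ⌈ n /2⌉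
    b = ⌊ n /2⌋
    n≡ : n ≡ a + b
    n≡ = trans (sym (⌊n/2⌋+⌈n/2⌉≡n n)) (+-comm b a)
    b≤a : b ≤ a
    b≤a = ⌊n/2⌋≤⌈n/2⌉ n
    a≤1+b : a ≤ suc b
    a≤1+b = s≤s (⌊n/2⌋-mono (n≤1+n (suc n-2)))
    expand : ∀ c → 4 * suc c ≡ suc (suc c) + suc c + (1 + 2 * c)
    expand = solve-∀
    a+b≤4b : a + b ≤ 4 * b
    a+b≤4b = ≤-trans (+-monoˡ-≤ b a≤1+b)
      (subst (suc b + b ≤_) (sym (expand ⌊ n-2 /2⌋)) (m≤m+n (suc b + b) _))

-- Coincidences modulo p in a grid

-- With n ones among the values, the first sum counts the pairs of ones, and 2 · n(n - 1)/2 + n =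
-- n².
2∑pairs+∑≡∑² : ∀ N {χ : ℕ → ℕ} → (∀ i → χ i ≡ 0 ⊎ χ i ≡ 1) →
               2 * ∑ N (λ i → χ i * ∑ i χ) + ∑ N χ ≡ ∑ N χ * ∑ N χ
2∑pairs+∑≡∑² zero          h = refl
2∑pairs+∑≡∑² (suc N) {χ} h with χ N | h N
... | _ | inj₁ refl rewrite +-identityʳ (∑ N (λ i → χ i * ∑ i χ)) | +-identityʳ (∑ N χ) =
  2∑pairs+∑≡∑² N h
... | _ | inj₂ refl = begin
  2 * (A + (n + 0)) + (n + 1)    ≡⟨ expand A n ⟩
  (2 * A + n) + (2 * n + 1)      ≡⟨ cong (_+ (2 * n + 1)) (2∑pairs+∑≡∑² N h) ⟩
  n * n + (2 * n + 1)            ≡⟨ square n ⟩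
  (n + 1) * (n + 1)              ∎
  where
  open ≡-Reasoning
  A = ∑ N (λ i → χ i * ∑ i χ)
  n = ∑ N χ
  expand : ∀ A n → 2 * (A + (n + 0)) + (n + 1) ≡ (2 * A + n) + (2 * n + 1)
  expand = solve-∀
  square : ∀ n → n * n + (2 * n + 1) ≡ (n + 1) * (n + 1)
  square = solve-∀

-- (n − s)(n − s − 1) ≥ 0, free of subtraction.
consecutive-product≥0 : ∀ n s → 2 * s * n + n ≤ n * n + s * (s + 1)
consecutive-product≥0 n s with ≤-total n s
... | inj₁ n≤s with m≤n⇒∃[o]m+o≡n n≤s
...   | k , refl = subst (2 * (n + k) * n + n ≤_) (expand n k) (m≤m+n _ (k * k + k))
  where
  expand : ∀ n k → 2 * (n + k) * n + n + (k * k + k) ≡ n * n + (n + k) * (n + k + 1)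
  expand = solve-∀
consecutive-product≥0 n s | inj₂ s≤n with m≤n⇒∃[o]m+o≡n s≤n
... | zero , refl = ≤-reflexive (expand s)
  where
  expand : ∀ s → 2 * s * (s + 0) + (s + 0) ≡ (s + 0) * (s + 0) + s * (s + 1)
  expand = solve-∀
... | suc k , refl = subst (2 * s * (s + suc k) + (s + suc k) ≤_) (expand s k) (m≤m+n _ (k * k + k))
  where
  expand : ∀ s k → 2 * s * (s + suc k) + (s + suc k) + (k * k + k) ≡ (s + suc k) * (s + suc k) + s * (s + 1)
  expand = solve-∀

coincidences : ℕ → (ℕ → ℕ) → ℕ
coincidences N f = ∑ N (λ i → ∑ i (λ j → 𝟙 (f i ≟ f j)))

𝟙-0∨1 : {P : Set} (P? : Dec P) → 𝟙 P? ≡ 0 ⊎ 𝟙 P? ≡ 1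
𝟙-0∨1 (yes _) = inj₂ refl
𝟙-0∨1 (no  _) = inj₁ refl

∑-𝟙-miss : ∀ p {u} → p ≤ u → ∑ p (λ c → 𝟙 (u ≟ c)) ≡ 0
∑-𝟙-miss zero    p≤u = refl
∑-𝟙-miss (suc p) {u} p<u with u ≟ p
... | yes refl = contradiction p<u (<-irrefl refl)
... | no  _    = trans (+-identityʳ _) (∑-𝟙-miss p (<⇒≤ p<u))

∑-𝟙-hit : ∀ {p u} → u < p → ∑ p (λ c → 𝟙 (u ≟ c)) ≡ 1
∑-𝟙-hit {suc p} {u} u<1+p with u ≟ p
... | yes refl = cong (_+ 1) (∑-𝟙-miss p ≤-refl)
... | no  u≢p  = trans (+-identityʳ _) (∑-𝟙-hit (≤∧≢⇒< (s≤s⁻¹ u<1+p) u≢p))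

-- Prepares the summation over classes `c`: on the right only the second factor depends on `c`, and
-- it sums to 1.
𝟙*𝟙≤ : ∀ u w c → 𝟙 (u ≟ c) * 𝟙 (w ≟ c) ≤ 𝟙 (u ≟ w) * 𝟙 (u ≟ c)
𝟙*𝟙≤ u w c with u ≟ c
... | no  _    = z≤n
... | yes refl with w ≟ u
...   | no  _    = z≤n
...   | yes refl = ≤-reflexive (cong (_* 1) (sym (𝟙-yes (u ≟ u) refl)))

-- Summed over the p residue classes, n(n − 1)/2 ≥ sn − s(s + 1)/2 bounds the coincidences of
-- f from below; s ≈ N/p is the optimal slope.
coincidences≥ : ∀ {p} N {f} → (∀ i → f i < p) → ∀ s →
                2 * s * N ≤ 2 * coincidences N f + p * (s * (s + 1))
coincidences≥ {p} N {f} f<p s = begin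
  2 * s * N                                                ≡⟨ cong (2 * s *_) N≡ ⟨
  2 * s * ∑ p n                                            ≡⟨ ∑-*ˡ p (2 * s) n ⟨
  ∑ p (λ c → 2 * s * n c)                                  ≤⟨ ∑-mono p (λ c _ → perClass c) ⟩
  ∑ p (λ c → 2 * A c + s * (s + 1))                        ≡⟨ ∑-+ p _ _ ⟩
  ∑ p (λ c → 2 * A c) + ∑ p (λ _ → s * (s + 1))            ≡⟨ cong₂ _+_ (∑-*ˡ p 2 A) (∑-const p (s * (s + 1))) ⟩
  2 * ∑ p A + p * (s * (s + 1))                            ≤⟨ +-monoˡ-≤ _ (*-monoʳ-≤ 2 ∑A≤) ⟩
  2 * coincidences N f + p * (s * (s + 1))                 ∎
  where
  open ≤-Reasoning
  χ : ℕ → ℕ → ℕ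
  χ c i = 𝟙 (f i ≟ c)
  n A : ℕ → ℕ
  n c = ∑ N (χ c)
  A c = ∑ N (λ i → χ c i * ∑ i (χ c))
  N≡ : ∑ p n ≡ N
  N≡ = trans (∑-swap p N χ) (trans (∑-cong N (λ i → ∑-𝟙-hit (f<p i))) (trans (∑-const N 1) (*-identityʳ N)))
  -- Substituting n² = 2A + n into (n - s)(n - s - 1) ≥ 0 lets n cancel.
  perClass : ∀ c → 2 * s * n c ≤ 2 * A c + s * (s + 1)
  perClass c = +-cancelʳ-≤ (n c) _ _ (≤-trans (consecutive-product≥0 (n c) s)
    (≤-reflexive (trans (cong (_+ s * (s + 1)) (sym (2∑pairs+∑≡∑² N (λ i → 𝟙-0∨1 (f i ≟ c)))))
                        (rearrange (2 * A c) (n c) (s * (s + 1))))))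
    where
    rearrange : ∀ a b d → a + b + d ≡ a + d + b
    rearrange = solve-∀
  pairs : ∀ i → ∑ p (λ c → χ c i * ∑ i (χ c)) ≤ ∑ i (λ j → 𝟙 (f i ≟ f j))
  pairs i = begin
    ∑ p (λ c → χ c i * ∑ i (χ c))                          ≡⟨ ∑-cong p (λ c → ∑-*ˡ i (χ c i) (χ c)) ⟨
    ∑ p (λ c → ∑ i (λ j → χ c i * χ c j))                  ≡⟨ ∑-swap p i _ ⟩
    ∑ i (λ j → ∑ p (λ c → χ c i * χ c j))                  ≤⟨ ∑-mono i (λ j _ → pair j) ⟩
    ∑ i (λ j → 𝟙 (f i ≟ f j))                              ∎
    where
    pair : ∀ j → ∑ p (λ c → χ c i * χ c j) ≤ 𝟙 (f i ≟ f j)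
    pair j = begin
      ∑ p (λ c → χ c i * χ c j)                            ≤⟨ ∑-mono p (λ c _ → 𝟙*𝟙≤ (f i) (f j) c) ⟩
      ∑ p (λ c → 𝟙 (f i ≟ f j) * χ c i)                    ≡⟨ ∑-*ˡ p (𝟙 (f i ≟ f j)) (λ c → χ c i) ⟩
      𝟙 (f i ≟ f j) * ∑ p (λ c → χ c i)                    ≡⟨ cong (𝟙 (f i ≟ f j) *_) (∑-𝟙-hit (f<p i)) ⟩
      𝟙 (f i ≟ f j) * 1                                    ≡⟨ *-identityʳ _ ⟩
      𝟙 (f i ≟ f j)                                        ∎
  ∑A≤ : ∑ p A ≤ coincidences N f
  ∑A≤ = ≤-trans (≤-reflexive (∑-swap p N (λ c i → χ c i * ∑ i (χ c)))) (∑-mono N (λ i _ → pairs i))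

∣m+n∣n⇒∣m : ∀ {d} m {n} → d ∣ m + n → d ∣ n → d ∣ m
∣m+n∣n⇒∣m {d} m {n} h = ∣m+n∣m⇒∣n (subst (d ∣_) (+-comm m n) h)

-- Modulo `p`, z ≡ w ≡ -w′; the number `w′` takes the place of a negative.
%-≡⇒∣ : ∀ {p} .{{_ : NonZero p}} u {z w w′} → (u + z) % p ≡ (u + w) % p → p ∣ w + w′ → p ∣ z + w′
%-≡⇒∣ {p} u {z} {w} {w′} eq d = ∣m+n∣n⇒∣m (z + w′) {q′ * p}
    (subst (p ∣_) (sym balance) (∣m∣n⇒∣m+n d (n∣m*n q))) (n∣m*n q′)
  where
  q = (u + z) / p
  q′ = (u + w) / p
  rearrange₁ : ∀ u z w′ x → u + (z + w′ + x) ≡ (u + z) + (w′ + x)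
  rearrange₁ = solve-∀
  rearrange₂ : ∀ c x y w′ → (c + x) + (w′ + y) ≡ (c + y) + (w′ + x)
  rearrange₂ = solve-∀
  balance : z + w′ + q′ * p ≡ w + w′ + q * p
  balance = +-cancelˡ-≡ u _ _ (begin
    u + (z + w′ + q′ * p)                         ≡⟨ rearrange₁ u z w′ (q′ * p) ⟩
    (u + z) + (w′ + q′ * p)                       ≡⟨ cong (_+ (w′ + q′ * p)) (m≡m%n+[m/n]*n (u + z) p) ⟩
    ((u + z) % p + q * p) + (w′ + q′ * p)         ≡⟨ cong (λ c → (c + q * p) + (w′ + q′ * p)) eq ⟩
    ((u + w) % p + q * p) + (w′ + q′ * p)         ≡⟨ rearrange₂ ((u + w) % p) (q * p) (q′ * p) w′ ⟩
    ((u + w) % p + q′ * p) + (w′ + q * p)         ≡⟨ cong (_+ (w′ + q * p)) (m≡m%n+[m/n]*n (u + w) p) ⟨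
    (u + w) + (w′ + q * p)                        ≡⟨ rearrange₁ u w w′ (q * p) ⟨
    u + (w + w′ + q * p)                          ∎)
    where open ≡-Reasoning

-- Divisibility of the form 2x² + ly² by a prime

form : ℕ → ℕ → ℕ → ℕ
form l x y = 2 * (x * x) + l * (y * y)

-- From x ≡ -ry follows 2x² + ly² ≡ y²(2r² + l) ≡ 0. The multiple of x + ry added in `identity`
-- avoids subtraction.
∣form : ∀ {p} l r x y → p ∣ 2 * (r * r) + l → p ∣ x + r * y → p ∣ form l x y
∣form {p} l r x y root d = ∣m+n∣n⇒∣m (form l x y)
    (subst (p ∣_) (sym (identity x r y l)) (∣m∣n⇒∣m+n (∣n⇒∣m*n (2 * (x + r * y)) d) (∣n⇒∣m*n (y * y) root)))
    (∣n⇒∣m*n (4 * (r * y)) d)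
  where
  identity : ∀ x r y l → 2 * (x * x) + l * (y * y) + 4 * (r * y) * (x + r * y) ≡
                         2 * (x + r * y) * (x + r * y) + y * y * (2 * (r * r) + l)
  identity = solve-∀

2<p∧p∣2m⇒p∣m : ∀ {p m} → Prime p → 2 < p → p ∣ 2 * m → p ∣ m
2<p∧p∣2m⇒p∣m {p} {m} p-prime 2<p d with euclidsLemma 2 m p-prime d
... | inj₁ p∣2 = contradiction (∣⇒≤ p∣2) (<⇒≱ 2<p)
... | inj₂ p∣m = p∣m

module _ {p l : ℕ} (p-prime : Prime p) (2<p : 2 < p) (p∤l : ¬ p ∣ l) where

  p∤root : ∀ {r} → p ∣ 2 * (r * r) + l → ¬ p ∣ r
  p∤root {r} root p∣r = p∤l (∣m+n∣m⇒∣n root (∣n⇒∣m*n 2 (∣n⇒∣m*n r p∣r)))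

  -- Either congruence alone gives one factor `p` by `∣form`. If both hold, their sum gives p ∣ 2x,
  -- so p ∣ x; then p ∣ ry with p ∤ r gives p ∣ y, and p² divides the form. So the counts for the
  -- two opposite roots may be added.
  v-form≥ : ∀ {A B : Set} (A? : Dec A) (B? : Dec B) {r r′ x y} → 0 < form l x y →
            p ∣ 2 * (r * r) + l → p ∣ 2 * (r′ * r′) + l → p ∣ r + r′ →
            (A → p ∣ x + r * y) → (B → p ∣ x + r′ * y) → 𝟙 A? + 𝟙 B? ≤ v p (form l x y)
  v-form≥ (no  _) (no  _) _   _    _     _ _  _  = z≤n
  v-form≥ (no  _) (yes b) {r} {r′} {x} {y} pos _ root′ _ _ hB = ∣⇒v>0 p-prime pos (∣form l r′ x y root′ (hB b))
  v-form≥ (yes a) (no  _) {r} {r′} {x} {y} pos root _ _ hA _ = ∣⇒v>0 p-prime pos (∣form l r x y root (hA a))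
  v-form≥ (yes a) (yes b) {r} {r′} {x} {y} pos root _ d hA hB = v-max (prime>1 p-prime) pos p²∣
    where
    sum : ∀ x r r′ y → (x + r * y) + (x + r′ * y) ≡ 2 * x + (r + r′) * y
    sum = solve-∀
    p∣x : p ∣ x
    p∣x = 2<p∧p∣2m⇒p∣m p-prime 2<p (∣m+n∣n⇒∣m (2 * x)
            (subst (p ∣_) (sum x r r′ y) (∣m∣n⇒∣m+n (hA a) (hB b))) (∣m⇒∣m*n y d))
    p∣y : p ∣ y
    p∣y with euclidsLemma r y p-prime (∣m+n∣m⇒∣n (hA a) p∣x)
    ... | inj₁ p∣r = contradiction p∣r (p∤root root)
    ... | inj₂ q   = q
    p²∣ : p ^ 2 ∣ form l x y
    p²∣ = subst (λ k → p * k ∣ form l x y) (sym (*-identityʳ p))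
      (∣m∣n⇒∣m+n (∣n⇒∣m*n 2 (*-pres-∣ p∣x p∣x)) (∣n⇒∣m*n l (*-pres-∣ p∣y p∣y)))

∣-∣-cases : ∀ a b → (a ≡ b + ∣ a - b ∣) ⊎ (b ≡ a + ∣ a - b ∣)
∣-∣-cases a b with ≤-total b a
... | inj₁ b≤a = inj₁ (trans (sym (m+[n∸m]≡n b≤a)) (cong (b +_) (sym (m≤n⇒∣n-m∣≡n∸m b≤a))))
... | inj₂ a≤b = inj₂ (trans (sym (m+[n∸m]≡n a≤b)) (cong (a +_) (sym (m≤n⇒∣m-n∣≡n∸m a≤b))))

∣m-n∣<⇒ : ∀ {m n k} → m < k → n < k → ∣ m - n ∣ ≤ k
∣m-n∣<⇒ {m} {n} m<k n<k = ≤-trans (∣m-n∣≤m⊔n m n) (⊔-lub (<⇒≤ m<k) (<⇒≤ n<k))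

-- The product of the form over all pairs of grid points

module _ (l m : ℕ) .{{_ : NonZero m}} where

  -- i < m² encodes the point (i / m, i % m) of the m × m grid.
  diffForm : ℕ → ℕ → ℕ
  diffForm i j = form l ∣ i / m - j / m ∣ ∣ i % m - j % m ∣

  gridProduct : ℕ
  gridProduct = ∏ (m * m) (λ i → ∏ i (diffForm i))

  diffForm>0 : 0 < l → ∀ {i j} → j < i → 0 < diffForm i j
  diffForm>0 0<l {i} {j} j<i with ∣ i / m - j / m ∣ in eq₁ | ∣ i % m - j % m ∣ in eq₂
  ... | suc x | _     = z<s
  ... | zero  | suc y = *-mono-≤ 0<l (z<s {y + y * suc y})
  ... | zero  | zero  = contradiction (sym i≡j) (<⇒≢ j<i)
    where
    i≡j : i ≡ j
    i≡j = begin
      i                      ≡⟨ m≡m%n+[m/n]*n i m ⟩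
      i % m + (i / m) * m    ≡⟨ cong₂ (λ a b → a + b * m) (∣m-n∣≡0⇒m≡n {i % m} {j % m} eq₂) (∣m-n∣≡0⇒m≡n {i / m} {j / m} eq₁) ⟩
      j % m + (j / m) * m    ≡⟨ m≡m%n+[m/n]*n j m ⟨
      j                      ∎
      where open ≡-Reasoning

  diffForm≤ : ∀ {i j} → i < m * m → j < m * m → diffForm i j ≤ (2 + l) * (m * m)
  diffForm≤ {i} {j} i<m² j<m² = ≤-trans
    (+-mono-≤ (*-monoʳ-≤ 2 (*-mono-≤ x≤m x≤m)) (*-monoʳ-≤ l (*-mono-≤ y≤m y≤m)))
    (≤-reflexive (sym (*-distribʳ-+ (m * m) 2 l)))
    where
    x≤m = ∣m-n∣<⇒ (m<n*o⇒m/o<n {i} {m} {m} i<m²) (m<n*o⇒m/o<n {j} {m} {m} j<m²)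
    y≤m = ∣m-n∣<⇒ (m%n<n i m) (m%n<n j m)

  gridProduct>0 : 0 < l → 0 < gridProduct
  gridProduct>0 0<l = ∏-pos (m * m) (λ i _ → ∏-pos i (λ j j<i → diffForm>0 0<l j<i))

  -- There are N(N - 1)/2 factors, each at most (2 + l)N; squaring keeps the exponent integral.
  gridProduct²≤ : gridProduct * gridProduct ≤ ((2 + l) * (m * m)) ^ ((m * m) * (m * m))
  gridProduct²≤ = begin
    gridProduct * gridProduct                  ≤⟨ *-mono-≤ bound bound ⟩
    X ^ ∑ N (λ i → i) * X ^ ∑ N (λ i → i)      ≡⟨ ^-distribˡ-+-* X (∑ N (λ i → i)) (∑ N (λ i → i)) ⟨
    X ^ (∑ N (λ i → i) + ∑ N (λ i → i))        ≤⟨ ^-monoʳ-≤ X {{m*n≢0 (2 + l) N {{_}} {{m*n≢0 m m}}}} (triangle N) ⟩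
    X ^ (N * N)                                ∎
    where
    open ≤-Reasoning
    N = m * m
    X = (2 + l) * N
    triangle : ∀ n → ∑ n (λ i → i) + ∑ n (λ i → i) ≤ n * n
    triangle zero    = z≤n
    triangle (suc n) = begin
      (∑ n (λ i → i) + n) + (∑ n (λ i → i) + n)   ≡⟨ +-interchange (∑ n (λ i → i)) n _ n ⟩
      (∑ n (λ i → i) + ∑ n (λ i → i)) + (n + n)   ≤⟨ +-monoˡ-≤ (n + n) (triangle n) ⟩
      n * n + (n + n)                             ≤⟨ n≤1+n _ ⟩
      suc (n * n + (n + n))                       ≡⟨ square n ⟩
      suc n * suc n                               ∎
      where
      square : ∀ n → suc (n * n + (n + n)) ≡ suc n * suc n
      square = solve-∀
    bound : gridProduct ≤ X ^ ∑ N (λ i → i)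
    bound = ≤-trans (∏-mono N (λ i i<N → ≤-trans
        (∏-mono i (λ j j<i → diffForm≤ i<N (<-trans j<i i<N))) (≤-reflexive (∏-const i X))))
      (≤-reflexive (∏-exponents N X (λ i → i)))

  module _ {p} (p-prime : Prime p) (2<p : 2 < p) (0<l : 0 < l) (p∤l : ¬ p ∣ l)
           {r} (root : p ∣ 2 * (r * r) + l) where

    private
      N = m * m
      instance p≢0 = prime⇒nonZero p-prime
      -- r′ ≡ −r (mod p)
      r′ = pred p * r
      r+r′ : p ∣ r + r′
      r+r′ = subst (λ q → p ∣ q * r) (sym (suc-pred p)) (m∣m*n r)
      root′ : p ∣ 2 * (r′ * r′) + l
      root′ = subst (λ k → p ∣ 2 * (r′ * r′) + k) (*-identityʳ l)
        (∣form l r r′ 1 root (subst (p ∣_) (trans (+-comm r r′) (cong (r′ +_) (sym (*-identityʳ r)))) r+r′))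
      residue : ℕ → ℕ → ℕ
      residue ρ i = (i / m + ρ * (i % m)) % p

      same : ∀ ρ a′ b′ x y → ((a′ + x) + ρ * (b′ + y)) % p ≡ (a′ + ρ * b′) % p → p ∣ x + ρ * y
      same ρ a′ b′ x y eq = subst (p ∣_) (+-identityʳ _) (%-≡⇒∣ (a′ + ρ * b′) {w = 0} {w′ = 0}
          (subst₂ (λ s t → s % p ≡ t % p) (expand a′ x ρ b′ y) (sym (+-identityʳ _)) eq) (p ∣0))
        where
        expand : ∀ a x ρ b y → (a + x) + ρ * (b + y) ≡ (a + ρ * b) + (x + ρ * y)
        expand = solve-∀

      -- When the two coordinates change in opposite directions, equal residues for ρ mean x ≡ ρy,
      -- which is the congruence x + ρ′y ≡ 0 of the opposite root.
      opposite : ∀ ρ ρ′ a′ b x y → p ∣ ρ + ρ′ →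
                 ((a′ + x) + ρ * b) % p ≡ (a′ + ρ * (b + y)) % p → p ∣ x + ρ′ * y
      opposite ρ ρ′ a′ b x y d eq = %-≡⇒∣ (a′ + ρ * b)
          (subst₂ (λ s t → s % p ≡ t % p) (expand₁ a′ x (ρ * b)) (expand₂ a′ ρ b y) eq)
          (subst (p ∣_) (*-distribʳ-+ y ρ ρ′) (∣m⇒∣m*n y d))
        where
        expand₁ : ∀ a x c → (a + x) + c ≡ (a + c) + x
        expand₁ = solve-∀
        expand₂ : ∀ a ρ b y → a + ρ * (b + y) ≡ (a + ρ * b) + ρ * y
        expand₂ = solve-∀

    -- `diffForm` sees only absolute differences. If the coordinates change in the same direction,
    -- each root yields its own congruence; otherwise `r` and `r′` exchange roles. Hence four cases.
    v-diffForm≥ : ∀ {i j} → j < i →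
      𝟙 (residue r i ≟ residue r j) + 𝟙 (residue r′ i ≟ residue r′ j) ≤ v p (diffForm i j)
    v-diffForm≥ {i} {j} j<i = go (∣-∣-cases a a′) (∣-∣-cases b b′)
      where
      a = i / m
      b = i % m
      a′ = j / m
      b′ = j % m
      x = ∣ a - a′ ∣
      y = ∣ b - b′ ∣
      E? = residue r i ≟ residue r j
      E′? = residue r′ i ≟ residue r′ j
      r′+r : p ∣ r′ + r
      r′+r = subst (p ∣_) (+-comm r r′) r+r′
      apply : ∀ ρ ρ′ → p ∣ 2 * (ρ * ρ) + l → p ∣ 2 * (ρ′ * ρ′) + l → p ∣ ρ + ρ′ →
              (residue r i ≡ residue r j → p ∣ x + ρ * y) →
              (residue r′ i ≡ residue r′ j → p ∣ x + ρ′ * y) →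
              𝟙 E? + 𝟙 E′? ≤ v p (diffForm i j)
      apply ρ ρ′ h h′ d = v-form≥ p-prime 2<p p∤l E? E′? {ρ} {ρ′} (diffForm>0 0<l j<i) h h′ d
      go : (a ≡ a′ + x) ⊎ (a′ ≡ a + x) → (b ≡ b′ + y) ⊎ (b′ ≡ b + y) → 𝟙 E? + 𝟙 E′? ≤ v p (diffForm i j)
      go (inj₁ a≡) (inj₁ b≡) = apply r r′ root root′ r+r′ (f r) (f r′)
        where
        f : ∀ ρ → residue ρ i ≡ residue ρ j → p ∣ x + ρ * y
        f ρ eq = same ρ a′ b′ x y (trans (cong₂ (λ s t → (s + ρ * t) % p) (sym a≡) (sym b≡)) eq)
      go (inj₁ a≡) (inj₂ b≡) = apply r′ r root′ root r′+r (f r r′ r+r′) (f r′ r r′+r)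
        where
        f : ∀ ρ ρ′ → p ∣ ρ + ρ′ → residue ρ i ≡ residue ρ j → p ∣ x + ρ′ * y
        f ρ ρ′ d eq = opposite ρ ρ′ a′ b x y d
          (trans (cong (λ s → (s + ρ * b) % p) (sym a≡)) (trans eq (cong (λ t → (a′ + ρ * t) % p) b≡)))
      go (inj₂ a≡) (inj₁ b≡) = apply r′ r root′ root r′+r (f r r′ r+r′) (f r′ r r′+r)
        where
        f : ∀ ρ ρ′ → p ∣ ρ + ρ′ → residue ρ i ≡ residue ρ j → p ∣ x + ρ′ * y
        f ρ ρ′ d eq = opposite ρ ρ′ a b′ x y d
          (trans (cong (λ s → (s + ρ * b′) % p) (sym a≡)) (trans (sym eq) (cong (λ t → (a + ρ * t) % p) b≡)))
      go (inj₂ a≡) (inj₂ b≡) = apply r r′ root root′ r+r′ (f r) (f r′)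
        where
        f : ∀ ρ → residue ρ i ≡ residue ρ j → p ∣ x + ρ * y
        f ρ eq = same ρ a b x y (trans (cong₂ (λ s t → (s + ρ * t) % p) (sym a≡) (sym b≡)) (sym eq))

    -- `coincidences≥` applies to the residues of both `r` and `r′`, and `v-diffForm≥` adds the two
    -- counts.
    v-gridProduct≥ : ∀ s → 2 * s * N ≤ v p gridProduct + p * (s * (s + 1))
    v-gridProduct≥ s = *-cancelˡ-≤ 2 (begin
      2 * (2 * s * N)                                               ≡⟨ double (2 * s * N) ⟩
      2 * s * N + 2 * s * N                                         ≤⟨ +-mono-≤ (coincidences≥ N (λ i → m%n<n _ p) s) (coincidences≥ N (λ i → m%n<n _ p) s) ⟩
      (2 * D + K) + (2 * D′ + K)                                    ≡⟨ collect D D′ K ⟩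
      2 * ((D + D′) + K)                                            ≤⟨ *-monoʳ-≤ 2 (+-monoˡ-≤ K D+D′≤) ⟩
      2 * (v p gridProduct + K)                                     ∎)
      where
      open ≤-Reasoning
      D = coincidences N (residue r)
      D′ = coincidences N (residue r′)
      K = p * (s * (s + 1))
      double : ∀ a → 2 * a ≡ a + a
      double = solve-∀
      collect : ∀ D D′ K → (2 * D + K) + (2 * D′ + K) ≡ 2 * ((D + D′) + K)
      collect = solve-∀
      E : ℕ → ℕ → ℕ → ℕ
      E ρ i j = 𝟙 (residue ρ i ≟ residue ρ j)
      D+D′≤ : D + D′ ≤ v p gridProduct
      D+D′≤ = begin
        D + D′                                     ≡⟨ ∑-+ N (λ i → ∑ i (E r i)) (λ i → ∑ i (E r′ i)) ⟨
        ∑ N (λ i → ∑ i (E r i) + ∑ i (E r′ i))     ≡⟨ ∑-cong N (λ i → ∑-+ i (E r i) (E r′ i)) ⟨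
        ∑ N (λ i → ∑ i (λ j → E r i j + E r′ i j)) ≤⟨ ∑-mono N (λ i _ → ∑-mono i (λ j j<i → v-diffForm≥ j<i)) ⟩
        ∑ N (λ i → ∑ i (λ j → v p (diffForm i j))) ≡⟨ ∑-cong N (λ i → v-∏ p-prime i (λ j j<i → diffForm>0 0<l j<i)) ⟨
        ∑ N (λ i → v p (∏ i (diffForm i)))         ≡⟨ v-∏ p-prime N (λ i _ → ∏-pos i (λ j j<i → diffForm>0 0<l j<i)) ⟨
        v p gridProduct                            ∎

    -- The slope s = ⌊N/p⌋ gives N² ≤ pe + 2pN, and 20p ≤ N makes the last summand at most N²/10.
    p*v-gridProduct≥ : 20 * p ≤ N → 9 * (N * N) ≤ 10 * (p * v p gridProduct)
    p*v-gridProduct≥ 20p≤N = +-cancelˡ-≤ (N * N) _ _ (begin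
      N * N + 9 * (N * N)                 ≡⟨ ten (N * N) ⟩
      10 * (N * N)                        ≤⟨ *-monoʳ-≤ 10 N²≤ ⟩
      10 * (p * e + 2 * (p * N))          ≡⟨ regroup p e N ⟩
      20 * p * N + 10 * (p * e)           ≤⟨ +-monoˡ-≤ (10 * (p * e)) (*-monoˡ-≤ N 20p≤N) ⟩
      N * N + 10 * (p * e)                ∎)
      where
      open ≤-Reasoning
      e = v p gridProduct
      s = N / p
      ten : ∀ a → a + 9 * a ≡ 10 * a
      ten = solve-∀
      regroup : ∀ p e N → 10 * (p * e + 2 * (p * N)) ≡ 20 * p * N + 10 * (p * e)
      regroup = solve-∀
      regroup₁ : ∀ s N → s * N + (s + 1) * N ≡ 2 * s * N + N
      regroup₁ = solve-∀
      regroup₂ : ∀ p s → p * (s * (s + 1)) ≡ s * p * (s + 1)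
      regroup₂ = solve-∀
      regroup₃ : ∀ e s N → e + N * (s + 1) + N ≡ e + N + (s + 1) * N
      regroup₃ = solve-∀
      regroup₄ : ∀ p s N → (p + s * p) * N ≡ p * N + p * (s * N)
      regroup₄ = solve-∀
      regroup₅ : ∀ p e N → p * N + p * (e + N) ≡ p * e + 2 * (p * N)
      regroup₅ = solve-∀
      sN≤e+N : s * N ≤ e + N
      -- Since sp ≤ N, the loss p · s(s + 1) is at most N(s + 1).
      sN≤e+N = +-cancelʳ-≤ ((s + 1) * N) _ _ (begin
        s * N + (s + 1) * N               ≡⟨ regroup₁ s N ⟩
        2 * s * N + N                     ≤⟨ +-monoˡ-≤ N (v-gridProduct≥ s) ⟩
        e + p * (s * (s + 1)) + N         ≡⟨ cong (λ k → e + k + N) (regroup₂ p s) ⟩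
        e + s * p * (s + 1) + N           ≤⟨ +-monoˡ-≤ N (+-monoʳ-≤ e (*-monoˡ-≤ (s + 1) (m/n*n≤m N p))) ⟩
        e + N * (s + 1) + N               ≡⟨ regroup₃ e s N ⟩
        e + N + (s + 1) * N               ∎)
      N²≤ : N * N ≤ p * e + 2 * (p * N)
      N²≤ = begin
        N * N                             ≤⟨ *-monoˡ-≤ N (≤-trans (≤-reflexive (m≡m%n+[m/n]*n N p))
                                               (+-monoˡ-≤ (s * p) (<⇒≤ (m%n<n N p)))) ⟩
        (p + s * p) * N                   ≡⟨ regroup₄ p s N ⟩
        p * N + p * (s * N)               ≤⟨ +-monoʳ-≤ (p * N) (*-monoʳ-≤ p sN≤e+N) ⟩
        p * N + p * (e + N)               ≡⟨ regroup₅ p e N ⟩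
        p * e + 2 * (p * N)               ∎

-- Valuations of the terms

prime^∣-cancelˡ : ∀ {p a b} j → Prime p → ¬ p ∣ a → p ^ j ∣ a * b → p ^ j ∣ b
prime^∣-cancelˡ {p} {zero}          j p-prime p∤a d = contradiction (p ∣0) p∤a
prime^∣-cancelˡ {p} {suc _} {zero}  j p-prime p∤a d = (p ^ j) ∣0
prime^∣-cancelˡ {p} {a@(suc _)} {b@(suc _)} j p-prime p∤a d = ∣-trans (^-∣-^ p j≤vb) (v-∣ p b)
  where
  j≤vb : j ≤ v p b
  j≤vb = subst (j ≤_) (trans (v-* {p} {a} {b} p-prime z<s z<s) (cong (_+ v p b) (∤⇒v≡0 p∤a)))
                      (v-max {p} {a * b} (prime>1 p-prime) z<s d)

module _ {P : ℕ → Set} (P? : ∀ i → Dec (P i)) where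

  count : ℕ → ℕ
  count n = ∑ n (λ i → 𝟙 (P? i))

  count≤0 : ∀ n → (∀ i → i < n → ¬ P i) → count n ≤ 0
  count≤0 zero    h = z≤n
  count≤0 (suc n) h with P? n
  ... | yes p = contradiction p (h n ≤-refl)
  ... | no  _ = ≤-trans (≤-reflexive (+-identityʳ _)) (count≤0 n (λ i i<n → h i (m<n⇒m<1+n i<n)))

  count≤1 : ∀ n → (∀ i j → i < j → j < n → P i → ¬ P j) → count n ≤ 1
  count≤1 zero    h = z≤n
  count≤1 (suc n) h with P? n
  ... | yes p = +-monoˡ-≤ 1 (count≤0 n (λ i i<n pᵢ → h i n i<n ≤-refl pᵢ p))
  ... | no  _ = ≤-trans (≤-reflexive (+-identityʳ _))
                        (count≤1 n (λ i j i<j j<n → h i j i<j (m<n⇒m<1+n j<n)))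

  count≤2 : ∀ n → (∀ i j k → i < j → j < k → k < n → P i → P j → ¬ P k) → count n ≤ 2
  count≤2 zero    h = z≤n
  count≤2 (suc n) h with P? n
  ... | yes p = +-monoˡ-≤ 1 (count≤1 n (λ i j i<j j<n pᵢ pⱼ → h i j n i<j j<n ≤-refl pᵢ pⱼ p))
  ... | no  _ = ≤-trans (≤-reflexive (+-identityʳ _))
                        (count≤2 n (λ i j k i<j j<k k<n → h i j k i<j j<k (m<n⇒m<1+n k<n)))

∑-blocks : ∀ q k {f c} → (∀ a → ∑ q (λ i → f (a + i)) ≤ c) → ∑ (k * q) f ≤ k * c
∑-blocks q zero    h = z≤n
∑-blocks q (suc k) {f} {c} h = begin
  ∑ (q + k * q) f                                     ≡⟨ cong (λ n → ∑ n f) (+-comm q (k * q)) ⟩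
  ∑ (k * q + q) f                                     ≡⟨ ∑-split (k * q) q f ⟩
  ∑ (k * q) f + ∑ q (λ i → f (k * q + i))             ≤⟨ +-mono-≤ (∑-blocks q k h) (h (k * q)) ⟩
  k * c + c                                           ≡⟨ +-comm (k * c) c ⟩
  c + k * c                                           ∎
  where open ≤-Reasoning

∑-monoˡ : ∀ {m n} f → m ≤ n → ∑ m f ≤ ∑ n f
∑-monoˡ {m} f m≤n with m≤n⇒∃[o]m+o≡n m≤n
... | k , refl = subst (∑ m f ≤_) (sym (∑-split m k f)) (m≤m+n _ _)

-- ⌊T/q⌋ + 1 windows of length `q` cover the first `T` indices.
∑-windows : ∀ q .{{_ : NonZero q}} T {f c} → (∀ a → ∑ q (λ i → f (a + i)) ≤ c) → ∑ T f ≤ suc (T / q) * c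
∑-windows q T {f} h = ≤-trans (∑-monoˡ f T≤) (∑-blocks q (suc (T / q)) h)
  where
  T≤ : T ≤ suc (T / q) * q
  T≤ = ≤-trans (≤-reflexive (m≡m%n+[m/n]*n T q)) (+-monoˡ-≤ _ (<⇒≤ (m%n<n T q)))

value : ℕ → ℕ → ℕ
value l k = 2 * (k * k) + l

-- Along k ≡ 1 (mod l) the values are coprime to 2l.
term : ℕ → ℕ → ℕ
term l t = value l (suc (l * t))

-- ⌊log X / log p⌋ for p > 1 and X ≥ 1.
logFloor : ℕ → ℕ → ℕ
logFloor p X = greatest (λ j → p ^ j ≤? X) X

^logFloor≤ : ∀ p {X} → 1 ≤ X → p ^ logFloor p X ≤ X
^logFloor≤ p {X} 1≤X = greatest-holds (λ j → p ^ j ≤? X) 1≤X X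

logFloor-max : ∀ {p X j} → 1 < p → p ^ j ≤ X → j ≤ logFloor p X
logFloor-max {p} {X} {j} 1<p h = greatest-max (λ j → p ^ j ≤? X) X (≤-trans (<⇒≤ (n<b^n 1<p j)) h) h

0<d<q⇒q∤d : ∀ {q d} → 0 < d → d < q → ¬ q ∣ d
0<d<q⇒q∤d 0<d d<q q∣d = <⇒≱ d<q (∣⇒≤ {{>-nonZero 0<d}} q∣d)

-- The geometric series Σ T/p^j ≤ T/(p - 1) with floors. Carrying the last quotient along makes the
-- induction telescope through p⌊x/p⌋ ≤ x.
geometric-floor : ∀ p .{{_ : NonZero p}} T J →
  pred p * ∑ J (λ j → (T / p ^ suc j) {{m^n≢0 p (suc j)}}) + (T / p ^ J) {{m^n≢0 p J}} ≤ T
geometric-floor p T zero = ≤-reflexive (trans (cong (_+ T / 1) (*-zeroʳ (pred p))) (n/1≡n T))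
geometric-floor p@(suc p′) T (suc J) = begin
  p′ * (g + y) + y        ≡⟨ rearrange p′ g y ⟩
  p′ * g + p * y          ≤⟨ +-monoʳ-≤ (p′ * g) p*y≤x ⟩
  p′ * g + x              ≤⟨ geometric-floor p T J ⟩
  T                       ∎
  where
  open ≤-Reasoning
  instance
    p^J≢0 : NonZero (p ^ J)
    p^J≢0 = m^n≢0 p J
    p^[1+J]≢0 : NonZero (p ^ suc J)
    p^[1+J]≢0 = m^n≢0 p (suc J)
    p^J*p≢0 : NonZero (p ^ J * p)
    p^J*p≢0 = m*n≢0 (p ^ J) p
  g = ∑ J (λ j → (T / p ^ suc j) {{m^n≢0 p (suc j)}})
  x = T / p ^ J
  y = T / p ^ suc J
  rearrange : ∀ p′ g y → p′ * (g + y) + y ≡ p′ * g + suc p′ * y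
  rearrange = solve-∀
  y≡ : y ≡ x / p
  y≡ = trans (/-congʳ (*-comm p (p ^ J))) (sym (m/n/o≡m/[n*o] T (p ^ J) p))
  p*y≤x : p * y ≤ x
  p*y≤x = subst (λ z → p * z ≤ x) (sym y≡) (≤-trans (≤-reflexive (*-comm p (x / p))) (m/n*n≤m x p))

-- Roots of the terms modulo prime powers

module _ {p l : ℕ} (p-prime : Prime p) (2<p : 2 < p) (p∤l : ¬ p ∣ l) where

  private instance p≢0 = prime⇒nonZero p-prime

  p∤2 : ¬ p ∣ 2
  p∤2 p∣2 = <⇒≱ 2<p (∣⇒≤ p∣2)

  -- The difference of the two terms is 2l times this product, and `p` is coprime to 2l.
  ∣difference : ∀ j x d → p ^ j ∣ term l x → p ^ j ∣ term l (x + d) → p ^ j ∣ d * (2 + l * (2 * x + d))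
  ∣difference j x d hx hd = prime^∣-cancelˡ j p-prime p∤l (prime^∣-cancelˡ j p-prime p∤2
      (∣m+n∣m⇒∣n (subst (p ^ j ∣_) (identity l x d) hd) hx))
    where
    identity : ∀ l x d → 2 * (suc (l * (x + d)) * suc (l * (x + d))) + l ≡
                         2 * (suc (l * x) * suc (l * x)) + l + 2 * (l * (d * (2 + l * (2 * x + d))))
    identity = solve-∀

  -- `p` cannot divide both factors of the difference: it would then divide 2k with k = 1 + lx,
  -- hence k, and so l = (2k² + l) - 2k². The whole prime power therefore falls on one factor.
  term-pair : ∀ j x d → p ^ suc j ∣ term l x → p ^ suc j ∣ term l (x + d) →
              p ^ suc j ∣ d ⊎ p ^ suc j ∣ 2 + l * (2 * x + d)
  term-pair j x d hx hd with p ∣? d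
  ... | no  p∤d = inj₂ (prime^∣-cancelˡ (suc j) p-prime p∤d (∣difference (suc j) x d hx hd))
  ... | yes p∣d = inj₁ (prime^∣-cancelˡ (suc j) p-prime p∤w
                    (subst (p ^ suc j ∣_) (*-comm d w) (∣difference (suc j) x d hx hd)))
    where
    w = 2 + l * (2 * x + d)
    k = suc (l * x)
    identity : ∀ l x d → 2 + l * (2 * x + d) ≡ 2 * suc (l * x) + l * d
    identity = solve-∀
    p∤w : ¬ p ∣ w
    p∤w p∣w = p∤l (∣m+n∣m⇒∣n (m*n∣⇒m∣ p (p ^ j) hx) (∣n⇒∣m*n 2 (∣n⇒∣m*n k p∣k)))
      where
      p∣k : p ∣ k
      p∣k = 2<p∧p∣2m⇒p∣m p-prime 2<p
        (∣m+n∣n⇒∣m (2 * k) (subst (p ∣_) (identity l x d) p∣w) (∣n⇒∣m*n l p∣d))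

  -- A quadratic has at most two roots here. For three roots, `term-pair` applies to the first with
  -- each of the others; distances below `q` leave only the second alternative, and subtraction
  -- gives q ∣ l(i₃ - i₂), which is impossible.
  term-window : ∀ j a → ∑ (p ^ suc j) (λ i → 𝟙 (p ^ suc j ∣? term l (a + i))) ≤ 2
  term-window j a = count≤2 (λ i → q ∣? term l (a + i)) q noTriple
    where
    q = p ^ suc j
    noTriple : ∀ i₁ i₂ i₃ → i₁ < i₂ → i₂ < i₃ → i₃ < q →
               q ∣ term l (a + i₁) → q ∣ term l (a + i₂) → ¬ q ∣ term l (a + i₃)
    noTriple i₁ i₂ i₃ i₁<i₂ i₂<i₃ i₃<q h₁ h₂ h₃
      with m≤n⇒∃[o]m+o≡n i₁<i₂ | m≤n⇒∃[o]m+o≡n i₂<i₃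
    ... | d , refl | e , refl = 0<d<q⇒q∤d {q} {suc e} z<s e<q
        (prime^∣-cancelˡ (suc j) p-prime p∤l (∣m+n∣m⇒∣n (subst (q ∣_) (shift l x d e) w₃) w₂))
      where
      x = a + i₁
      split₂ : ∀ a i d → a + (suc i + d) ≡ a + i + suc d
      split₂ = solve-∀
      split₃ : ∀ a i d e → a + (suc (suc i + d) + e) ≡ a + i + (suc d + suc e)
      split₃ = solve-∀
      sum₃ : ∀ i d e → suc (suc i + d) + e ≡ i + (suc d + suc e)
      sum₃ = solve-∀
      shift : ∀ l x d e → 2 + l * (2 * x + (suc d + suc e)) ≡ 2 + l * (2 * x + suc d) + l * suc e
      shift = solve-∀
      d+e<q : suc d + suc e < q
      d+e<q = ≤-<-trans (≤-trans (m≤n+m _ i₁) (≤-reflexive (sym (sum₃ i₁ d e)))) i₃<q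
      e<q : suc e < q
      e<q = ≤-<-trans (m≤n+m (suc e) (suc d)) d+e<q
      d<q : suc d < q
      d<q = ≤-<-trans (m≤m+n (suc d) (suc e)) d+e<q
      second : ∀ {δ} → 0 < δ → δ < q → q ∣ term l (x + δ) → q ∣ 2 + l * (2 * x + δ)
      second {δ} 0<δ δ<q h with term-pair j x δ h₁ h
      ... | inj₁ q∣δ = contradiction q∣δ (0<d<q⇒q∤d 0<δ δ<q)
      ... | inj₂ q∣w = q∣w
      w₂ : q ∣ 2 + l * (2 * x + suc d)
      w₂ = second z<s d<q (subst (λ y → q ∣ term l y) (split₂ a i₁ d) h₂)
      w₃ : q ∣ 2 + l * (2 * x + (suc d + suc e))
      w₃ = second z<s d+e<q (subst (λ y → q ∣ term l y) (split₃ a i₁ d e) h₃)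

  v≤∑𝟙 : ∀ {X m} → 0 < m → m ≤ X → v p m ≤ ∑ (logFloor p X) (λ j → 𝟙 (p ^ suc j ∣? m))
  v≤∑𝟙 {X} {m} 0<m m≤X = ≤-trans (hits (v p m) ≤-refl) (∑-monoˡ _ v≤J)
    where
    v≤J : v p m ≤ logFloor p X
    v≤J = logFloor-max (prime>1 p-prime) (≤-trans (∣⇒≤ {{>-nonZero 0<m}} (v-∣ p m)) m≤X)
    hits : ∀ k → k ≤ v p m → k ≤ ∑ k (λ j → 𝟙 (p ^ suc j ∣? m))
    hits zero    _   = z≤n
    hits (suc k) k<v = ≤-trans (≤-reflexive (+-comm 1 k)) (+-mono-≤ (hits k (<⇒≤ k<v))
      (≤-reflexive (sym (𝟙-yes (p ^ suc k ∣? m) (∣-trans (^-∣-^ p k<v) (v-∣ p m))))))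

  -- At each level `j` the windows give at most 2(⌊T/p^(j+1)⌋ + 1). The quotients add up to `g`, and
  -- the extra ones make up the error 2J.
  ∑v-term≤ : ∀ T {X} → 0 < l → (∀ t → t < T → term l t ≤ X) →
             ∃[ g ] (pred p * g ≤ T × ∑ T (λ t → v p (term l t)) ≤ 2 * g + 2 * logFloor p X)
  ∑v-term≤ T {X} 0<l bound = g , ≤-trans (m≤m+n _ _) (geometric-floor p T J) , (begin
    ∑ T (λ t → v p (term l t))                                ≤⟨ ∑-mono T (λ t t<T → v≤∑𝟙 (term>0 t) (bound t t<T)) ⟩
    ∑ T (λ t → ∑ J (λ j → 𝟙 (p ^ suc j ∣? term l t)))         ≡⟨ ∑-swap T J _ ⟩
    ∑ J (λ j → ∑ T (λ t → 𝟙 (p ^ suc j ∣? term l t)))         ≤⟨ ∑-mono J (λ j _ → ∑-windows (p ^ suc j) {{m^n≢0 p (suc j)}} T (term-window j)) ⟩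
    ∑ J (λ j → suc (G j) * 2)                                 ≡⟨ ∑-cong J (λ j → rearrange (G j)) ⟩
    ∑ J (λ j → 2 * G j + 2)                                   ≡⟨ ∑-+ J (λ j → 2 * G j) (λ _ → 2) ⟩
    ∑ J (λ j → 2 * G j) + ∑ J (λ _ → 2)                       ≡⟨ cong₂ _+_ (∑-*ˡ J 2 G) (trans (∑-const J 2) (*-comm J 2)) ⟩
    2 * g + 2 * J                                             ∎)
    where
    open ≤-Reasoning
    J = logFloor p X
    G : ℕ → ℕ
    G j = (T / p ^ suc j) {{m^n≢0 p (suc j)}}
    g = ∑ J G
    rearrange : ∀ y → suc y * 2 ≡ 2 * y + 2
    rearrange = solve-∀
    term>0 : ∀ t → 0 < term l t
    term>0 t = ≤-trans 0<l (m≤n+m l _)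

  v-∏-term : ∀ T → 0 < l → v p (∏ T (term l)) ≡ ∑ T (λ t → v p (term l t))
  v-∏-term T 0<l = v-∏ p-prime T (λ t _ → ≤-trans 0<l (m≤n+m l _))

  -- 9N² ≤ 10pe for e the valuation of the grid product, while the terms have valuation at
  -- most 2g up to the error, with (p − 1)g ≤ 24u and hence 2pg ≤ 72u since p ≥ 3.
  v-terms≤ : ∀ u m .{{_ : NonZero m}} {X} → 0 < l → (∀ t → t < 24 * u → term l t ≤ X) → 20 * p ≤ m * m →
             v p (∏ (24 * u) (term l)) * ((m * m) * (m * m)) ≤
             v p (gridProduct l m) * (80 * u) + 2 * logFloor p X * ((m * m) * (m * m))
  v-terms≤ u m {X} 0<l bound 20p≤N with v p (∏ (24 * u) (term l)) in eq
  ... | zero  = z≤n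
  -- A positive valuation supplies a term divisible by `p`, whose 1 + lt is the root that the grid
  -- bound requires.
  ... | suc k with ∑-nonzero (24 * u) (λ t → v p (term l t)) (subst (0 <_) (trans (sym eq) (v-∏-term (24 * u) 0<l)) z<s)
  ...   | t , _ , 0<v with ∑v-term≤ (24 * u) 0<l bound
  ...     | g , pg≤T , α≤ = begin
    suc k * N²                               ≤⟨ *-monoˡ-≤ N² (subst (_≤ 2 * g + 2 * J) (trans (sym (v-∏-term (24 * u) 0<l)) eq) α≤) ⟩
    (2 * g + 2 * J) * N²                     ≡⟨ *-distribʳ-+ N² (2 * g) (2 * J) ⟩
    2 * g * N² + 2 * J * N²                  ≤⟨ +-monoˡ-≤ (2 * J * N²) gN²≤ ⟩
    e * (80 * u) + 2 * J * N²                ∎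
    where
    open ≤-Reasoning
    J = logFloor p X
    N² = (m * m) * (m * m)
    e = v p (gridProduct l m)
    r = suc (l * t)
    N²≤ : 9 * N² ≤ 10 * (p * e)
    N²≤ = p*v-gridProduct≥ l m p-prime 2<p 0<l p∤l {r} (v>0⇒∣ 0<v) 20p≤N
    2p≤3[p-1] : 2 * p ≤ 3 * pred p
    2p≤3[p-1] = subst (λ n → 2 * n ≤ 3 * pred p) (suc-pred p) (begin
      2 * suc (pred p)         ≡⟨ *-suc 2 (pred p) ⟩
      2 + 2 * pred p           ≤⟨ +-monoˡ-≤ (2 * pred p) (<⇒≤pred 2<p) ⟩
      3 * pred p               ∎)
    2pg≤72u : 2 * p * g ≤ 72 * u
    2pg≤72u = begin
      2 * p * g                ≤⟨ *-monoˡ-≤ g 2p≤3[p-1] ⟩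
      3 * pred p * g           ≡⟨ *-assoc 3 (pred p) g ⟩
      3 * (pred p * g)         ≤⟨ *-monoʳ-≤ 3 pg≤T ⟩
      3 * (24 * u)             ≡⟨ *-assoc 3 24 u ⟨
      72 * u                   ∎
    regroup₁ : ∀ p g n → 9 * p * (2 * g * n) ≡ 2 * p * g * (9 * n)
    regroup₁ = solve-∀
    regroup₂ : ∀ u p e → 72 * u * (10 * (p * e)) ≡ 9 * p * (e * (80 * u))
    regroup₂ = solve-∀
    gN²≤ : 2 * g * N² ≤ e * (80 * u)
    -- Multiplying 2pg ≤ 72u by 9N² ≤ 10pe gives the constant 80 = 72 · 10/9.
    gN²≤ = *-cancelˡ-≤ (9 * p) {{m*n≢0 9 p}} (begin
      9 * p * (2 * g * N²)         ≡⟨ regroup₁ p g N² ⟩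
      2 * p * g * (9 * N²)         ≤⟨ *-mono-≤ 2pg≤72u N²≤ ⟩
      72 * u * (10 * (p * e))      ≡⟨ regroup₂ u p e ⟩
      9 * p * (e * (80 * u))       ∎)

-- Primes dividing a square product

P2≡∏ : ∀ l n → P2 l n ≡ ∏ n (λ i → value l (suc i))
P2≡∏ l zero    = refl
P2≡∏ l (suc n) = cong (_* value l (suc n)) (P2≡∏ l n)

factor∣∏ : ∀ {n f q i} → i < n → q ∣ f i → q ∣ ∏ n f
factor∣∏ {suc n} {f} i<1+n q∣ with m<1+n⇒m<n∨m≡n i<1+n
... | inj₁ i<n  = ∣m⇒∣m*n (f n) (factor∣∏ i<n q∣)
... | inj₂ refl = ∣n⇒∣m*n (∏ n f) q∣

-- A prime q > 2n divides at most one of the values at 1, …, n, and to the first power only,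
-- whereas it divides a square to an even power.
square⇒primes≤2n : ∀ {l n q} → 0 < l → l ≤ n → IsSquare (P2 l n) → Prime q →
                   ∀ {i} → i < n → q ∣ value l (suc i) → q ≤ 2 * n
square⇒primes≤2n {l} {n} {q} 0<l l≤n (r , P≡r²) q-prime {i} i<n q∣ with q ≤? 2 * n
... | yes q≤2n = q≤2n
... | no  q≰2n = contradiction (≤-trans (+-mono-≤ 0<vr 0<vr) (≤-trans (≤-reflexive vr+vr≡) ∑≤1)) (<-irrefl refl)
  where
  2n<q : 2 * n < q
  2n<q = ≰⇒> q≰2n
  0<n : 0 < n
  0<n = ≤-trans (s≤s z≤n) i<n
  f : ℕ → ℕ
  f j = value l (suc j)
  f>0 : ∀ j → 0 < f j
  f>0 j = ≤-trans 0<l (m≤n+m l _)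
  q∣r : q ∣ r
  q∣r = reduce (euclidsLemma r r q-prime
    (subst (q ∣_) (trans (sym (P2≡∏ l n)) P≡r²) (factor∣∏ {f = f} i<n q∣)))
  0<r : 0 < r
  0<r = n≢0⇒n>0 (λ r≡0 → <⇒≢ (∏-pos n (λ j _ → f>0 j))
    (sym (trans (sym (P2≡∏ l n)) (trans P≡r² (cong (λ x → x * x) r≡0)))))
  0<vr : 0 < v q r
  0<vr = ∣⇒v>0 q-prime 0<r q∣r
  vr+vr≡ : v q r + v q r ≡ ∑ n (λ j → v q (f j))
  vr+vr≡ = trans (sym (v-* q-prime 0<r 0<r))
    (trans (cong (v q) (trans (sym P≡r²) (P2≡∏ l n))) (v-∏ q-prime n (λ j _ → f>0 j)))
  2n*2n : ∀ n → 2 * n * (2 * n) ≡ 2 * (n * n) + (n * n + n * n)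
  2n*2n = solve-∀
  -- As l ≤ n ≤ n², a value is at most 3n² < (2n)² < q².
  f<q² : ∀ j → j < n → f j < q ^ 2
  f<q² j j<n = begin-strict
    2 * (suc j * suc j) + l             ≤⟨ +-mono-≤ (*-monoʳ-≤ 2 (*-mono-≤ j<n j<n)) (≤-trans l≤n (m≤m*n n n {{>-nonZero 0<n}})) ⟩
    2 * (n * n) + n * n                 ≤⟨ +-monoʳ-≤ (2 * (n * n)) (m≤m+n (n * n) (n * n)) ⟩
    2 * (n * n) + (n * n + n * n)       ≡⟨ 2n*2n n ⟨
    2 * n * (2 * n)                     <⟨ *-mono-< 2n<q 2n<q ⟩
    q * q                               ≡⟨ cong (q *_) (*-identityʳ q) ⟨
    q ^ 2                               ∎
    where open ≤-Reasoning
  v≤𝟙 : ∀ j → j < n → v q (f j) ≤ 𝟙 (q ∣? f j)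
  v≤𝟙 j j<n with q ∣? f j
  ... | no  q∤ = ≤-reflexive (∤⇒v≡0 q∤)
  ... | yes _  = s≤s⁻¹ (≰⇒> λ 2≤v → <⇒≱ (f<q² j j<n)
                   (∣⇒≤ {{>-nonZero (f>0 j)}} (∣-trans (^-∣-^ q 2≤v) (v-∣ q (f j)))))
  -- The difference of the values at J < K ≤ n is 2(K - J)(K + J), and `q` exceeds each factor.
  unique : ∀ j k → j < k → k < n → q ∣ f j → ¬ q ∣ f k
  unique j k j<k k<n q∣fj q∣fk with m≤n⇒∃[o]m+o≡n j<k
  ... | d , refl = [ small (s≤s z≤n) (≤-trans (s≤s (s≤s z≤n)) 2+d≤2n)
                   , [ small z<s (≤-trans (n≤1+n _) 2+d≤2n) , small z<s sum≤2n ]′ ∘ euclidsLemma (suc d) _ q-prime ]′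
                   (euclidsLemma 2 _ q-prime (∣m+n∣m⇒∣n (subst (q ∣_) (identity l j d) q∣fk) q∣fj))
    where
    small : ∀ {m} → 0 < m → m ≤ 2 * n → ¬ q ∣ m
    small 0<m m≤2n = 0<d<q⇒q∤d 0<m (≤-<-trans m≤2n 2n<q)
    identity : ∀ l j d → 2 * (suc (suc j + d) * suc (suc j + d)) + l ≡
                         2 * (suc j * suc j) + l + 2 * (suc d * suc (suc (suc (j + j + d))))
    identity = solve-∀
    double : ∀ n → n + n ≡ 2 * n
    double = solve-∀
    sum≡ : ∀ j d → suc j + suc (suc j + d) ≡ suc (suc (suc (j + j + d)))
    sum≡ = solve-∀
    sum≤2n : suc (suc (suc (j + j + d))) ≤ 2 * n
    sum≤2n = subst₂ _≤_ (sum≡ j d) (double n) (+-mono-≤ (<-trans j<k k<n) k<n)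
    2+d≤2n : suc (suc d) ≤ 2 * n
    2+d≤2n = ≤-trans (s≤s (s≤s (≤-trans (m≤n+m d (j + j)) (n≤1+n _)))) sum≤2n
  ∑≤1 : ∑ n (λ j → v q (f j)) ≤ 1
  ∑≤1 = ≤-trans (∑-mono n v≤𝟙) (count≤1 (λ j → q ∣? f j) n unique)

-- The upper bound for the product of the terms

^-cancelʳ-≤ : ∀ {a b} k .{{_ : NonZero k}} → a ^ k ≤ b ^ k → a ≤ b
^-cancelʳ-≤ {a} {b} k h with a ≤? b
... | yes a≤b = a≤b
... | no  a≰b = contradiction h (<⇒≱ (^-monoˡ-< k (≰⇒> a≰b)))

^-swap : ∀ a m n → (a ^ m) ^ n ≡ (a ^ n) ^ m
^-swap a m n = trans (^-*-assoc a m n) (trans (cong (a ^_) (*-comm m n)) (sym (^-*-assoc a n m)))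

*-^ : ∀ a b k → (a * b) ^ k ≡ a ^ k * b ^ k
*-^ a b zero    = refl
*-^ a b (suc k) = trans (cong (a * b *_) (*-^ a b k)) (*-interchange a b (a ^ k) (b ^ k))

-- Collects, over all primes below `M`, the errors 2 log X/log p left by `∑v-term≤`.
errorFactor : ℕ → ℕ → ℕ
errorFactor M X = ∏ M (λ i → primeOr1 i ^ (2 * logFloor i X))

-- Fewer than `u` primes lie below `u`, and each contributes at most X². A prime p ≥ u has p³ > X,
-- so its exponent is at most 4, and the primorial bound controls the product of these.
errorFactor≤ : ∀ M {X u} → 1 ≤ X → X < u ^ 3 → errorFactor (suc M) X ≤ (X * X) ^ u * 16 ^ (4 * M)
errorFactor≤ M {X} {u} 1≤X X<u³ = begin
  errorFactor (suc M) X                                             ≤⟨ ∏-mono (suc M) (λ i _ → pointwise i) ⟩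
  ∏ (suc M) (λ i → (X * X) ^ 𝟙 (i <? u) * primeOr1 i ^ 4)           ≡⟨ ∏-* (suc M) _ (λ i → primeOr1 i ^ 4) ⟩
  ∏ (suc M) (λ i → (X * X) ^ 𝟙 (i <? u)) * ∏ (suc M) (λ i → primeOr1 i ^ 4)
                                                                    ≤⟨ *-mono-≤ (small (suc M)) large ⟩
  (X * X) ^ u * 16 ^ (4 * M)                                        ∎
  where
  open ≤-Reasoning
  instance
    X≢0 = >-nonZero 1≤X
    X²≢0 = m*n≢0 X X
  large : ∏ (suc M) (λ i → primeOr1 i ^ 4) ≤ 16 ^ (4 * M)
  large = begin
    ∏ (suc M) (λ i → primeOr1 i ^ 4)    ≡⟨ ∏-^ (suc M) primeOr1 4 ⟩
    ∏ (suc M) primeOr1 ^ 4              ≤⟨ ^-monoˡ-≤ 4 (primorial≤16^n M) ⟩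
    (16 ^ M) ^ 4                        ≡⟨ ^-*-assoc 16 M 4 ⟩
    16 ^ (M * 4)                        ≡⟨ cong (16 ^_) (*-comm M 4) ⟩
    16 ^ (4 * M)                        ∎
  small : ∀ k → ∏ k (λ i → (X * X) ^ 𝟙 (i <? u)) ≤ (X * X) ^ u
  small k = ≤-trans (≤-reflexive (∏-exponents k (X * X) (λ i → 𝟙 (i <? u)))) (^-monoʳ-≤ (X * X) (≤-trans (∑𝟙≤⊓ k) (m⊓n≤n k u)))
    where
    ∑𝟙≤⊓ : ∀ k → ∑ k (λ i → 𝟙 (i <? u)) ≤ k ⊓ u
    ∑𝟙≤⊓ zero    = z≤n
    ∑𝟙≤⊓ (suc k) with k <? u
    ... | yes k<u = ≤-trans (+-monoˡ-≤ 1 (≤-trans (∑𝟙≤⊓ k) (m⊓n≤m k u)))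
                            (≤-reflexive (trans (+-comm k 1) (sym (m≤n⇒m⊓n≡m k<u))))
    ... | no  k≮u = ≤-trans (≤-reflexive (+-identityʳ _)) (≤-trans (∑𝟙≤⊓ k) (⊓-monoˡ-≤ u (n≤1+n k)))
  pointwise : ∀ i → primeOr1 i ^ (2 * logFloor i X) ≤ (X * X) ^ 𝟙 (i <? u) * primeOr1 i ^ 4
  pointwise i with i <? u
  ... | no  i≮u = ≤-trans (primeOr1-^-mono i (λ p → *-monoʳ-≤ 2 (s≤s⁻¹ (≰⇒> (logFloor<3 p)))))
                          (≤-reflexive (sym (*-identityˡ _)))
    where
    logFloor<3 : Prime i → ¬ 3 ≤ logFloor i X
    logFloor<3 p 3≤J = <⇒≱ X<u³ (≤-trans (^-monoˡ-≤ 3 (≮⇒≥ i≮u))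
      (≤-trans (^-monoʳ-≤ i {{prime⇒nonZero p}} 3≤J) (^logFloor≤ i 1≤X)))
  ... | yes _ = ≤-trans square≤X² (m≤m*n _ _ {{>-nonZero (primeOr1^≥1 i 4)}})
    where
    J = logFloor i X
    primeOr1^J≤X : primeOr1 i ^ J ≤ X
    primeOr1^J≤X with prime? i
    ... | yes _ = ^logFloor≤ i 1≤X
    ... | no  _ = subst (_≤ X) (sym (^-zeroˡ J)) 1≤X
    square≤X² : primeOr1 i ^ (2 * J) ≤ (X * X) ^ 1
    square≤X² = begin
      primeOr1 i ^ (2 * J)                    ≡⟨ cong (λ k → primeOr1 i ^ (J + k)) (+-identityʳ J) ⟩
      primeOr1 i ^ (J + J)                    ≡⟨ ^-distribˡ-+-* (primeOr1 i) J J ⟩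
      primeOr1 i ^ J * primeOr1 i ^ J         ≤⟨ *-mono-≤ primeOr1^J≤X primeOr1^J≤X ⟩
      X * X                                   ≡⟨ ^-identityʳ (X * X) ⟨
      (X * X) ^ 1                             ∎

module _ {l : ℕ} (0<l : 0 < l) (2∤l : ¬ 2 ∣ l) where

  term>0 : ∀ t → 0 < term l t
  term>0 t = ≤-trans 0<l (m≤n+m l _)

  prime∣term⇒2< : ∀ {p t} → Prime p → p ∣ term l t → 2 < p
  prime∣term⇒2< {p} {t} p-prime d = ≤∧≢⇒< (prime>1 p-prime)
    (λ { refl → 2∤l (∣m+n∣m⇒∣n d (m∣m*n (suc (l * t) * suc (l * t)))) })

  -- If p ∣ l, then p ∣ 2k² with k = 1 + lt, so p ∣ k, and k ≡ 1 modulo `l` gives p ∣ 1.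
  prime∣term⇒∤l : ∀ {p t} → Prime p → p ∣ term l t → ¬ p ∣ l
  prime∣term⇒∤l {p} {t} p-prime d p∣l = ¬prime[1] (subst Prime (∣1⇒≡1 p∣1) p-prime)
    where
    k = suc (l * t)
    p∣kk : p ∣ k * k
    p∣kk = 2<p∧p∣2m⇒p∣m p-prime (prime∣term⇒2< {t = t} p-prime d) (∣m+n∣n⇒∣m (2 * (k * k)) d p∣l)
    p∣1 : p ∣ 1
    p∣1 = ∣m+n∣n⇒∣m 1 (reduce (euclidsLemma k k p-prime p∣kk)) (∣m⇒∣m*n t p∣l)

  prime∣∏⇒∃ : ∀ {p} T {f} → Prime p → p ∣ ∏ T f → ∃[ t ] (t < T × p ∣ f t)
  prime∣∏⇒∃ zero    p-prime d = contradiction (subst Prime (∣1⇒≡1 d) p-prime) ¬prime[1]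
  prime∣∏⇒∃ (suc T) {f} p-prime d with euclidsLemma (∏ T f) (f T) p-prime d
  ... | inj₂ d′ = T , ≤-refl , d′
  ... | inj₁ d′ with prime∣∏⇒∃ T p-prime d′
  ...   | t , t<T , e = t , m<n⇒m<1+n t<T , e

  -- `v-terms≤` is applied prime by prime to the N²-th power of the product, which clears the
  -- denominators. The square bound on the grid product halves the exponent 80u to 40u, and the
  -- N²-th root is taken at the end.
  ∏-term≤ : ∀ u m .{{_ : NonZero m}} M {X} →
            (∀ t → t < 24 * u → term l t ≤ X) → 20 * M ≤ m * m →
            (∀ {p} → Prime p → ∀ t → t < 24 * u → p ∣ term l t → p < M) →
            ∏ (24 * u) (term l) ≤ ((2 + l) * (m * m)) ^ (40 * u) * errorFactor M X
  ∏-term≤ u m M {X} bound 20M≤N primes<M = ^-cancelʳ-≤ N² {{m*n≢0 (m * m) (m * m) {{m*n≢0 m m}} {{m*n≢0 m m}}}} (begin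
    Π ^ N²                                                          ≤⟨ ^-monoˡ-≤ N² (smooth⇒≤smoothPart Π>0 smooth) ⟩
    smoothPart M Π ^ N²                                             ≡⟨ ∏-^ M (λ i → primeOr1 i ^ v i Π) N² ⟨
    ∏ M (λ i → (primeOr1 i ^ v i Π) ^ N²)                           ≤⟨ ∏-mono M pointwise ⟩
    ∏ M (λ i → (primeOr1 i ^ v i B) ^ (80 * u) * (primeOr1 i ^ (2 * logFloor i X)) ^ N²)
                                                                    ≡⟨ ∏-* M (λ i → (primeOr1 i ^ v i B) ^ (80 * u)) (λ i → (primeOr1 i ^ (2 * logFloor i X)) ^ N²) ⟩
    ∏ M (λ i → (primeOr1 i ^ v i B) ^ (80 * u)) * ∏ M (λ i → (primeOr1 i ^ (2 * logFloor i X)) ^ N²)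
                                                                    ≡⟨ cong₂ _*_ (∏-^ M (λ i → primeOr1 i ^ v i B) (80 * u)) (∏-^ M (λ i → primeOr1 i ^ (2 * logFloor i X)) N²) ⟩
    smoothPart M B ^ (80 * u) * E ^ N²                              ≤⟨ *-monoˡ-≤ (E ^ N²) (^-monoˡ-≤ (80 * u) (smoothPart≤ M (gridProduct>0 l m 0<l))) ⟩
    B ^ (80 * u) * E ^ N²                                           ≤⟨ *-monoˡ-≤ (E ^ N²) B≤ ⟩
    (Y ^ (40 * u)) ^ N² * E ^ N²                                    ≡⟨ *-^ (Y ^ (40 * u)) E N² ⟨
    (Y ^ (40 * u) * E) ^ N²                                         ∎)
    where
    open ≤-Reasoning
    N² = (m * m) * (m * m)
    Y = (2 + l) * (m * m)
    Π = ∏ (24 * u) (term l)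
    B = gridProduct l m
    E = errorFactor M X
    Π>0 : 0 < Π
    Π>0 = ∏-pos (24 * u) (λ t _ → term>0 t)
    smooth : ∀ {q} → Prime q → q ∣ Π → q < M
    smooth q-prime q∣Π with prime∣∏⇒∃ (24 * u) q-prime q∣Π
    ... | t , t<T , q∣t = primes<M q-prime t t<T q∣t
    B≤ : B ^ (80 * u) ≤ (Y ^ (40 * u)) ^ N²
    B≤ = begin
      B ^ (80 * u)               ≡⟨ cong (B ^_) (*-assoc 2 40 u) ⟩
      B ^ (2 * (40 * u))         ≡⟨ ^-*-assoc B 2 (40 * u) ⟨
      (B ^ 2) ^ (40 * u)         ≡⟨ cong (λ x → (B * x) ^ (40 * u)) (*-identityʳ B) ⟩
      (B * B) ^ (40 * u)         ≤⟨ ^-monoˡ-≤ (40 * u) (gridProduct²≤ l m) ⟩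
      (Y ^ N²) ^ (40 * u)        ≡⟨ ^-swap Y N² (40 * u) ⟩
      (Y ^ (40 * u)) ^ N²        ∎
    exponents : ∀ {p} → p < M → Prime p → v p Π * N² ≤ v p B * (80 * u) + 2 * logFloor p X * N²
    exponents {p} p<M p-prime with p ∣? Π
    ... | no  p∤Π rewrite ∤⇒v≡0 p∤Π = z≤n
    ... | yes p∣Π with prime∣∏⇒∃ (24 * u) p-prime p∣Π
    ...   | t , t<T , p∣t = v-terms≤ p-prime (prime∣term⇒2< {t = t} p-prime p∣t) (prime∣term⇒∤l {t = t} p-prime p∣t)
                              u m 0<l bound (≤-trans (*-monoʳ-≤ 20 (<⇒≤ p<M)) 20M≤N)
    pointwise : ∀ i → i < M → (primeOr1 i ^ v i Π) ^ N² ≤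
                (primeOr1 i ^ v i B) ^ (80 * u) * (primeOr1 i ^ (2 * logFloor i X)) ^ N²
    pointwise i i<M = begin
      (q ^ v i Π) ^ N²                                        ≡⟨ ^-*-assoc q (v i Π) N² ⟩
      q ^ (v i Π * N²)                                        ≤⟨ primeOr1-^-mono i (exponents i<M) ⟩
      q ^ (v i B * (80 * u) + 2 * logFloor i X * N²)          ≡⟨ ^-distribˡ-+-* q (v i B * (80 * u)) (2 * logFloor i X * N²) ⟩
      q ^ (v i B * (80 * u)) * q ^ (2 * logFloor i X * N²)    ≡⟨ cong₂ _*_ (^-*-assoc q (v i B) (80 * u)) (^-*-assoc q (2 * logFloor i X) N²) ⟨
      (q ^ v i B) ^ (80 * u) * (q ^ (2 * logFloor i X)) ^ N²  ∎
      where q = primeOr1 i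

-- Comparison of sizes

-- Everything is a `u`-th power. The roots satisfy u^46 ≤ K · u^(40 + 4), so u² ≤ K.
growth : ∀ a b c u → 0 < u →
  (u * u) ^ (23 * u) ≤ (a * u) ^ (40 * u) * ((c * (u * u) * (c * (u * u))) ^ u * 16 ^ (4 * (b * u))) →
  u ≤ a ^ 40 * (c * c) * 16 ^ (4 * b)
growth a b c u 0<u h = ≤-trans (m≤m*n u u) (*-cancelʳ-≤ (u * u) K W (begin
  u * u * W                                                   ≡⟨ cong (u * u *_) W≡ ⟩
  (u * u) ^ 23                                                ≤⟨ ^-cancelʳ-≤ u h′ ⟩
  (a * u) ^ 40 * (c * (u * u) * (c * (u * u)) * 16 ^ (4 * b)) ≡⟨ cong (_* (c * (u * u) * (c * (u * u)) * 16 ^ (4 * b))) (*-^ a u 40) ⟩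
  a ^ 40 * u ^ 40 * (c * (u * u) * (c * (u * u)) * 16 ^ (4 * b))
                                                              ≡⟨ regroup (a ^ 40) (u ^ 40) c (u * u) (16 ^ (4 * b)) ⟩
  K * W                                                       ∎))
  where
  open ≤-Reasoning
  K = a ^ 40 * (c * c) * 16 ^ (4 * b)
  W = u ^ 40 * (u * u * (u * u))
  instance
    u≢0 = >-nonZero 0<u
    W≢0 : NonZero W
    W≢0 = m*n≢0 (u ^ 40) (u * u * (u * u)) {{m^n≢0 u 40}} {{m*n≢0 (u * u) (u * u) {{m*n≢0 u u}} {{m*n≢0 u u}}}}
  regroup : ∀ A U c s G → A * U * (c * s * (c * s) * G) ≡ A * (c * c) * G * (U * (s * s))
  regroup = solve-∀
  W≡ : W ≡ (u * u) ^ 22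
  W≡ = begin-equality
    u ^ 40 * (u * u * (u * u))            ≡⟨ cong (_* (u * u * (u * u))) (trans (^-distribˡ-+-* u 20 20) (sym (*-^ u u 20))) ⟩
    (u * u) ^ 20 * (u * u * (u * u))      ≡⟨ cong (λ k → (u * u) ^ 20 * (u * u * k)) (sym (*-identityʳ (u * u))) ⟩
    (u * u) ^ 20 * (u * u) ^ 2            ≡⟨ ^-distribˡ-+-* (u * u) 20 2 ⟨
    (u * u) ^ 22                          ∎
  h′ : ((u * u) ^ 23) ^ u ≤ ((a * u) ^ 40 * (c * (u * u) * (c * (u * u)) * 16 ^ (4 * b))) ^ u
  h′ = begin
    ((u * u) ^ 23) ^ u                                         ≡⟨ ^-*-assoc (u * u) 23 u ⟩
    (u * u) ^ (23 * u)                                         ≤⟨ h ⟩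
    (a * u) ^ (40 * u) * (X² ^ u * 16 ^ (4 * (b * u)))         ≡⟨ cong₂ (λ x y → x * (X² ^ u * y)) (sym (^-*-assoc (a * u) 40 u))
                                                                    (trans (cong (16 ^_) (sym (*-assoc 4 b u))) (sym (^-*-assoc 16 (4 * b) u))) ⟩
    ((a * u) ^ 40) ^ u * (X² ^ u * (16 ^ (4 * b)) ^ u)         ≡⟨ cong (((a * u) ^ 40) ^ u *_) (*-^ X² (16 ^ (4 * b)) u) ⟨
    ((a * u) ^ 40) ^ u * (X² * 16 ^ (4 * b)) ^ u               ≡⟨ *-^ ((a * u) ^ 40) (X² * 16 ^ (4 * b)) u ⟨
    ((a * u) ^ 40 * (X² * 16 ^ (4 * b))) ^ u                   ∎
    where X² = c * (u * u) * (c * (u * u))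

-- The first `u` terms are bounded below by 1 only; each of the other 23u has t ≥ u.
∏-term≥ : ∀ {l} → 0 < l → ∀ u → (u * u) ^ (23 * u) ≤ ∏ (24 * u) (term l)
∏-term≥ {l} 0<l u = begin
  (u * u) ^ (23 * u)                                   ≡⟨ ∏-const (23 * u) (u * u) ⟨
  ∏ (23 * u) (λ _ → u * u)                             ≤⟨ ∏-mono (23 * u) (λ i _ → square≤ i) ⟩
  ∏ (23 * u) (λ i → term l (u + i))                    ≤⟨ m≤n*m _ (∏ u (term l)) {{>-nonZero (∏-pos u (λ t _ → ≤-trans 0<l (m≤n+m l _)))}} ⟩
  ∏ u (term l) * ∏ (23 * u) (λ i → term l (u + i))     ≡⟨ ∏-split u (23 * u) (term l) ⟨
  ∏ (u + 23 * u) (term l)                              ∎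
  where
  open ≤-Reasoning
  square≤ : ∀ i → u * u ≤ term l (u + i)
  square≤ i = ≤-trans (*-mono-≤ u≤k u≤k) (≤-trans (m≤m+n (k * k) (k * k + 0)) (m≤m+n (2 * (k * k)) l))
    where
    k = suc (l * (u + i))
    u≤k : u ≤ k
    u≤k = ≤-trans (m≤m+n u i) (≤-trans (m≤n*m (u + i) l {{>-nonZero 0<l}}) (n≤1+n _))

term≤ : ∀ {l u t} → 0 < l → 0 < u → t < 24 * u → term l t ≤ 3 * (24 * l * (24 * l)) * (u * u)
term≤ {l} {u} {t} 0<l 0<u t<T = begin
  2 * (suc (l * t) * suc (l * t)) + l         ≤⟨ +-mono-≤ (*-monoʳ-≤ 2 (*-mono-≤ k≤ k≤)) l≤ ⟩
  2 * (κ * κ) + κ * κ                         ≡⟨ regroup 24 l u ⟩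
  3 * (24 * l * (24 * l)) * (u * u)           ∎
  where
  open ≤-Reasoning
  κ = l * (24 * u)
  instance
    l≢0 = >-nonZero 0<l
    u≢0 = >-nonZero 0<u
    24u≢0 = m*n≢0 24 u
    κ≢0 = m*n≢0 l (24 * u)
  regroup : ∀ c l u → 2 * (l * (c * u) * (l * (c * u))) + l * (c * u) * (l * (c * u)) ≡
                      3 * (c * l * (c * l)) * (u * u)
  regroup = solve-∀
  k≤ : suc (l * t) ≤ κ
  k≤ = ≤-trans (+-monoˡ-≤ (l * t) 0<l) (≤-trans (≤-reflexive (sym (*-suc l t))) (*-monoʳ-≤ l t<T))
  l≤ : l ≤ κ * κ
  l≤ = ≤-trans (m≤m*n l (24 * u)) (m≤m*n κ κ)

-- Taking u = w² lets the grid of side 64lw have a multiple of `u` as its number of points. The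
-- constants come from (2 + l)N = au, from 2n + 1 ≤ bu with 193 = 2 · 24 · 4 + 1, and from the bound
-- cu² for the terms; 64² ≥ 20 · 193 makes the grid large enough. The condition c < u ensures cu² <
-- u³.
square⇒bounded : ∀ {l} → 0 < l → ¬ 2 ∣ l → ∀ {n w} → l ≤ n →
  let a = (2 + l) * (64 * l * (64 * l)); b = 193 * l; c = 3 * (24 * l * (24 * l)) in
  c < w * w → 24 * l * (w * w) ≤ n → n < 24 * l * (suc w * suc w) → IsSquare (P2 l n) →
  w * w ≤ a ^ 40 * (c * c) * 16 ^ (4 * b)
square⇒bounded {l} 0<l 2∤l {n} {w} l≤n c<u lower upper sq = growth a b c u 0<u (begin
  (u * u) ^ (23 * u)                                                         ≤⟨ ∏-term≥ 0<l u ⟩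
  ∏ (24 * u) (term l)                                                        ≤⟨ ∏-term≤ 0<l 2∤l u m {{m≢0}} M (λ t → term≤ 0<l 0<u) 20M≤N primes<M ⟩
  ((2 + l) * (m * m)) ^ (40 * u) * errorFactor M X                           ≤⟨ *-monoʳ-≤ (((2 + l) * (m * m)) ^ (40 * u)) (errorFactor≤ (2 * n) {u = u} 1≤X X<u³) ⟩
  ((2 + l) * (m * m)) ^ (40 * u) * ((X * X) ^ u * 16 ^ (4 * (2 * n)))        ≤⟨ *-mono-≤ (≤-reflexive (cong (_^ (40 * u)) (regroup 64 l w)))
                                                                                  (*-monoʳ-≤ ((X * X) ^ u) (^-monoʳ-≤ 16 (*-monoʳ-≤ 4 (<⇒≤ M≤bu)))) ⟩
  (a * u) ^ (40 * u) * ((X * X) ^ u * 16 ^ (4 * (b * u)))                    ∎)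
  where
  open ≤-Reasoning
  a = (2 + l) * (64 * l * (64 * l))
  b = 193 * l
  c = 3 * (24 * l * (24 * l))
  u = w * w
  m = 64 * l * w
  M = suc (2 * n)
  X = c * (u * u)
  0<u : 0 < u
  0<u = ≤-trans (s≤s z≤n) c<u
  0<w : 0 < w
  0<w = n≢0⇒n>0 (λ w≡0 → <⇒≢ 0<u (sym (cong (λ x → x * x) w≡0)))
  instance
    l≢0 = >-nonZero 0<l
    u≢0 = >-nonZero 0<u
    w≢0 = >-nonZero 0<w
    24l≢0 = m*n≢0 24 l
    64l≢0 = m*n≢0 64 l
    uu≢0 = m*n≢0 u u
  m≢0 : NonZero m
  m≢0 = m*n≢0 (64 * l) w
  regroup : ∀ k l w → (2 + l) * (k * l * w * (k * l * w)) ≡ (2 + l) * (k * l * (k * l)) * (w * w)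
  regroup = solve-∀
  1≤X : 1 ≤ X
  1≤X = *-mono-≤ {1} {c} (*-mono-≤ {1} {3} (s≤s z≤n) (*-mono-≤ {1} {24 * l} 0<24l 0<24l)) (*-mono-≤ 0<u 0<u)
    where
    0<24l : 1 ≤ 24 * l
    0<24l = >-nonZero⁻¹ (24 * l)
  X<u³ : X < u ^ 3
  X<u³ = begin-strict
    c * (u * u)         <⟨ *-monoˡ-< (u * u) c<u ⟩
    u * (u * u)         ≡⟨ cong (λ x → u * (u * x)) (*-identityʳ u) ⟨
    u ^ 3               ∎
  [1+w]²≤4u : suc w * suc w ≤ 4 * u
  [1+w]²≤4u = ≤-trans (*-mono-≤ 1+w≤2w 1+w≤2w) (≤-reflexive (square w))
    where
    1+w≤2w : suc w ≤ w + w
    1+w≤2w = +-monoˡ-≤ w 0<w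
    square : ∀ w → (w + w) * (w + w) ≡ 4 * (w * w)
    square = solve-∀
  M≤bu : M ≤ b * u
  M≤bu = begin
    suc (2 * n)                          ≤⟨ s≤s (*-monoʳ-≤ 2 (≤-trans (<⇒≤ upper) (*-monoʳ-≤ (24 * l) [1+w]²≤4u))) ⟩
    suc (2 * (24 * l * (4 * u)))         ≤⟨ +-monoˡ-≤ _ (*-mono-≤ 0<l 0<u) ⟩
    l * u + 2 * (24 * l * (4 * u))       ≡⟨ collect l u ⟩
    193 * l * u                          ∎
    where
    collect : ∀ l u → l * u + 2 * (24 * l * (4 * u)) ≡ 193 * l * u
    collect = solve-∀
  20M≤N : 20 * M ≤ m * m
  20M≤N = begin
    20 * M                           ≤⟨ *-monoʳ-≤ 20 M≤bu ⟩
    20 * (193 * l * u)               ≡⟨ trans (cong (20 *_) (*-assoc 193 l u)) (sym (*-assoc 20 193 (l * u))) ⟩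
    3860 * (l * u)                   ≤⟨ *-mono-≤ (m≤m+n 3860 236) (m≤n*m (l * u) l) ⟩
    4096 * (l * (l * u))             ≡⟨ square 64 l w ⟩
    m * m                            ∎
    where
    square : ∀ k l w → k * k * (l * (l * (w * w))) ≡ k * l * w * (k * l * w)
    square = solve-∀
  primes<M : ∀ {p} → Prime p → ∀ t → t < 24 * u → p ∣ term l t → p < M
  primes<M p-prime t t<T p∣t = s≤s (square⇒primes≤2n 0<l l≤n sq p-prime lt<n p∣t)
    where
    -- The `t`-th term is the value at k = 1 + lt, so k ≤ n makes it one of the factors of `P2 l n`.
    lt<n : l * t < n
    lt<n = begin-strict
      l * t              <⟨ *-monoʳ-< l t<T ⟩
      l * (24 * u)       ≡⟨ commute 24 l u ⟩
      24 * l * u         ≤⟨ lower ⟩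
      n                  ∎
      where
      commute : ∀ k l u → l * (k * u) ≡ k * l * u
      commute = solve-∀

-- The threshold

theorem1 : (l : ℕ) → 0 < l → ¬ (2 ∣ l) → ∃[ N ] (0 < N × ((n : ℕ) → N ≤ n → ¬ IsSquare (P2 l n)))
theorem1 l 0<l 2∤l = N , ≤-trans 0<l l≤N , notSquare
  where
  a = (2 + l) * (64 * l * (64 * l))
  b = 193 * l
  c = 3 * (24 * l * (24 * l))
  K = a ^ 40 * (c * c) * 16 ^ (4 * b)
  -- `S` exceeds both the bound `K` that a square would impose on w² and the constant `c` that w²
  -- has to exceed.
  S = suc (K + c)
  N = 24 * l * (S * S)
  instance
    l≢0 = >-nonZero 0<l
    24l≢0 = m*n≢0 24 l
  l≤N : l ≤ N
  l≤N = ≤-trans (m≤n*m l 24) (m≤m*n (24 * l) (S * S))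
  S≤N : S ≤ N
  S≤N = ≤-trans (m≤m*n S S) (m≤n*m (S * S) (24 * l))
  notSquare : ∀ n → N ≤ n → ¬ IsSquare (P2 l n)
  notSquare n N≤n sq = <⇒≱ K<u (square⇒bounded 0<l 2∤l {w = w} (≤-trans l≤N N≤n) c<u lower upper sq)
    where
    fits? = λ x → 24 * l * (x * x) ≤? n
    -- This is ⌊√(n/(24l))⌋; the search bound `n` suffices because x ≤ 24lx².
    w = greatest fits? n
    lower : 24 * l * (w * w) ≤ n
    lower = greatest-holds fits? (subst (_≤ n) (sym (*-zeroʳ (24 * l))) z≤n) n
    upper : n < 24 * l * (suc w * suc w)
    upper = ≰⇒> λ fits → <-irrefl refl (greatest-max fits? n
      (≤-trans (≤-trans (m≤m*n (suc w) (suc w)) (m≤n*m (suc w * suc w) (24 * l))) fits) fits)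
    S≤w : S ≤ w
    S≤w = greatest-max fits? n (≤-trans S≤N N≤n) N≤n
    S≤u : S ≤ w * w
    S≤u = ≤-trans S≤w (m≤m*n w w {{>-nonZero (≤-trans (s≤s z≤n) S≤w)}})
    K<u : K < w * w
    K<u = ≤-trans (s≤s (m≤m+n K c)) S≤u
    c<u : c < w * w
    c<u = ≤-trans (s≤s (m≤n+m c K)) S≤u
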